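{- Let $G=(V,E)$ be a finite simple connected graph with a vertex $w$. Then $$\beth^{2}(G/w)\le \beth^{2}(G),$$ where $G/w$ is a graph obtained from $G$ by vertex compression of $w$.
   Context: All graphs are finite and simple. A nonedge contraction of a pair $u,v$ of distinct nonadjacent vertices identifies $u$ and $v$ to a single vertex adjacent to exactly those other vertices that are adjacent to $u$ or $v$ (no loops or multiple edges). Vertex compression: for a vertex $w$ of $G$, let $G_w$ be the induced subgraph of $G$ with vertex set $\Gamma_G(w)\cup\{w\}$, where $\Gamma_G(w)$ is the set of neighbours of $w$. $G/w$ denotes the graph obtained from $G$ by successive nonedge contractions on (pairs of vertices of) $G_w$ so that $G_w$ becomes the complete graph $K_w:=K^{\chi(G_w)}$ on $\chi(G_w)$ vertices in $G/w$; the operation is called the vertex compression of $w$. Equivalently, one takes a proper colouring of $G_w$ with $\chi(G_w)$ colours and identifies, in $G$, the vertices within each colour class. The assertion is for any such choice. $C(G)$ denotes the set of all induced cycles in $G$ (of length at least 3). The second graph characteristic is $\beth^{2}(G)=|C(G)|-|E(G)|+|V(G)|$. -}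

module Defs where

open import Level using (0ℓ)
open import Function.Base using (id; _∘_; _on_)
open import Function.Bundles using (_⇔_)
open import Function.Definitions using (Injective; Surjective)
open import Data.Product.Base using (Σ; ∃; ∃-syntax; _×_; _,_; proj₁; proj₂)
open import Data.Sum.Base using (_⊎_; inj₁; inj₂; swap)
open import Data.Nat.Base as ℕ using (ℕ; zero; suc; s≤s)
import Data.Nat.Properties as ℕ
open import Data.Integer.Base as ℤ using (ℤ; +_)
open import Data.Fin.Base as Fin using (Fin; toℕ)
import Data.Fin.Properties as Fin
open import Data.Fin.Subset using (Subset; inside; outside; _∈_)
open import Data.Fin.Subset.Properties using (_∈?_)
open import Data.List.Base as List using (List; allFin; cartesianProduct; filter; length)
open import Data.Vec.Base using (Vec; []; _∷_; lookup)
open import Relation.Nullary using (¬_; Dec)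
open import Relation.Nullary.Decidable
  using (_×-dec_; _⊎-dec_; _→-dec_; ¬?; map′)
open import Relation.Unary using (Pred; Decidable)
open import Relation.Binary.Core using (Rel)
open import Relation.Binary.Definitions as B using (Symmetric)
open import Relation.Binary.PropositionalEquality
  using (_≡_; _≢_; refl; sym; trans)
open import Relation.Binary.Construct.Closure.ReflexiveTransitive using (Star)

record Graph (V : Set) : Set₁ where
  field
    Adj    : Rel V 0ℓ
    adj?   : B.Decidable Adj
    symm   : Symmetric Adj
    irrefl : ∀ {v} → ¬ Adj v v

open Graph public

private variable
  V W : Set
  k m n : ℕ

Connected : Graph V → Set
Connected G = ∀ u v → Star (Adj G) u v

induce : Graph V → (P : Pred V 0ℓ) → Graph (Σ V P)
induce G P = record
  { Adj    = Adj G on proj₁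
  ; adj?   = λ x y → adj? G (proj₁ x) (proj₁ y)
  ; symm   = symm G
  ; irrefl = irrefl G
  }

complete : ∀ k → Graph (Fin k)
complete k = record
  { Adj    = _≢_
  ; adj?   = λ i j → ¬? (i Fin.≟ j)
  ; symm   = λ i≢j j≡i → i≢j (sym j≡i)
  ; irrefl = λ i≢i → i≢i refl
  }

-- j follows i in the cyclic order 0, 1, …, 2 + k, 0.
Next : ∀ k → Rel (Fin (3 ℕ.+ k)) 0ℓ
Next k i j = suc (toℕ i) ≡ toℕ j ⊎ (toℕ i ≡ 2 ℕ.+ k × toℕ j ≡ 0)

next? : ∀ k → B.Decidable (Next k)
next? k i j = (suc (toℕ i) ℕ.≟ toℕ j) ⊎-dec
              ((toℕ i ℕ.≟ 2 ℕ.+ k) ×-dec (toℕ j ℕ.≟ 0))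

next-irrefl : ∀ k {i} → ¬ Next k i i
next-irrefl k (inj₁ eq)        = ℕ.1+n≢n eq
next-irrefl k (inj₂ (eq , eq′)) with trans (sym eq) eq′
... | ()

-- The cycle of length 3 + k.
cycle : ∀ k → Graph (Fin (3 ℕ.+ k))
cycle k = record
  { Adj    = λ i j → Next k i j ⊎ Next k j i
  ; adj?   = λ i j → next? k i j ⊎-dec next? k j i
  ; symm   = swap
  ; irrefl = λ { (inj₁ p) → next-irrefl k p ; (inj₂ p) → next-irrefl k p }
  }

-- e is an isomorphism from F onto the subgraph of G induced on P.
record IsIsoOnto {V W : Set} (F : Graph V) (G : Graph W) (P : Pred W 0ℓ)
                 (e : V → W) : Set where
  field
    injective  : Injective _≡_ _≡_ e
    into       : ∀ i → P (e i)
    onto       : ∀ {v} → P v → ∃[ i ] e i ≡ v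
    preserves  : ∀ i j → Adj F i j → Adj G (e i) (e j)
    reflects   : ∀ i j → Adj G (e i) (e j) → Adj F i j

Spans : Graph (Fin k) → Graph (Fin n) → Pred (Fin n) 0ℓ → Set
Spans {k} {n} F G P = Σ (Vec (Fin n) k) λ e → IsIsoOnto F G P (lookup e)

isIsoOnto? : (F : Graph (Fin k)) (G : Graph (Fin n)) {P : Pred (Fin n) 0ℓ} →
             Decidable P → (e : Fin k → Fin n) → Dec (IsIsoOnto F G P e)
isIsoOnto? F G P? e = map′
  (λ (a , b , c , d , f) → record
    { injective = λ {i} {j} → a i j
    ; into      = b
    ; onto      = λ {v} → c v
    ; preserves = d
    ; reflects  = f
    })
  (λ r → let open IsIsoOnto r in
    (λ i j → injective) , into , (λ v → onto) , preserves , reflects)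
  (  (Fin.all? λ i → Fin.all? λ j → (e i Fin.≟ e j) →-dec (i Fin.≟ j))
  ×-dec Fin.all? (λ i → P? (e i))
  ×-dec Fin.all? (λ v → P? v →-dec Fin.any? (λ i → e i Fin.≟ v))
  ×-dec (Fin.all? λ i → Fin.all? λ j → adj? F i j →-dec adj? G (e i) (e j))
  ×-dec (Fin.all? λ i → Fin.all? λ j → adj? G (e i) (e j) →-dec adj? F i j))

anyVec? : ∀ k {P : Pred (Vec (Fin n) k) 0ℓ} → Decidable P → Dec (∃ P)
anyVec? zero    P? = map′ ([] ,_) (λ { ([] , p) → p }) (P? [])
anyVec? (suc k) P? = map′
  (λ (x , xs , p) → x ∷ xs , p)
  (λ { (x ∷ xs , p) → x , xs , p })
  (Fin.any? λ x → anyVec? k λ xs → P? (x ∷ xs))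

spans? : (F : Graph (Fin k)) (G : Graph (Fin n)) {P : Pred (Fin n) 0ℓ} →
         Decidable P → Dec (Spans F G P)
spans? F G P? = anyVec? _ λ e → isIsoOnto? F G P? (lookup e)

-- An induced cycle is determined by its vertex set, so C(G) is represented
-- by the sets of vertices that induce a cycle.
IsInducedCycle : Graph (Fin n) → Pred (Subset n) 0ℓ
IsInducedCycle G S = ∃[ k ] Spans (cycle k) G (_∈ S)

isInducedCycle? : (G : Graph (Fin n)) → Decidable (IsInducedCycle G)
isInducedCycle? {n} G S = map′
  (λ (k , _ , s) → k , s)
  (λ (k , s) → k , bound s , s)
  (ℕ.anyUpTo? (λ k → spans? (cycle k) G (_∈? S)) n)
  where
  bound : ∀ {k} → Spans (cycle k) G (_∈ S) → k ℕ.< n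
  bound {k} (_ , iso) = ℕ.≤-trans (s≤s (ℕ.m≤n+m k 2))
    (Fin.injective⇒≤ (IsIsoOnto.injective iso))

subsets : ∀ n → List (Subset n)
subsets zero    = [] List.∷ List.[]
subsets (suc n) = List.map (inside ∷_) (subsets n) List.++
                  List.map (outside ∷_) (subsets n)

inducedCycles : Graph (Fin n) → List (Subset n)
inducedCycles {n} G = filter (isInducedCycle? G) (subsets n)

-- Each edge {i, j} is listed once, as the pair (i , j) with i < j.
edges : Graph (Fin n) → List (Fin n × Fin n)
edges {n} G = filter (λ (i , j) → (i Fin.<? j) ×-dec adj? G i j)
                     (cartesianProduct (allFin n) (allFin n))

ℶ² : Graph (Fin n) → ℤ
ℶ² {n} G = + length (inducedCycles G) ℤ.- + length (edges G) ℤ.+ + n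

Colourable : Graph V → ℕ → Set
Colourable {V} G k = Σ (V → Fin k) λ c → ∀ {x y} → Adj G x y → c x ≢ c y

IsChromaticNumber : Graph V → ℕ → Set
IsChromaticNumber G k = Colourable G k × (∀ j → Colourable G j → k ℕ.≤ j)

ClosedNbhd : Graph V → V → Pred V 0ℓ
ClosedNbhd G w v = v ≡ w ⊎ Adj G w v

-- H is obtained from G by identifying the distinct nonadjacent vertices u and
-- v, where f is the quotient map on vertices.
record IsNonedgeContraction {V W : Set} (G : Graph V) (u v : V)
                            (H : Graph W) (f : V → W) : Set where
  field
    distinct    : u ≢ v
    nonadjacent : ¬ Adj G u v
    surjective  : Surjective _≡_ _≡_ f
    identified  : f u ≡ f v
    only        : ∀ {x y} → f x ≡ f y →
                  x ≡ y ⊎ (x ≡ u × y ≡ v) ⊎ (x ≡ v × y ≡ u)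
    adj-merged  : ∀ {x} → x ≢ u → x ≢ v →
                  Adj H (f u) (f x) ⇔ (Adj G u x ⊎ Adj G v x)
    adj-others  : ∀ {x y} → x ≢ u → x ≢ v → y ≢ u → y ≢ v →
                  Adj H (f x) (f y) ⇔ Adj G x y

-- Successive nonedge contractions lead from G to H, each contracting a pair
-- of images of vertices in P; the function is the composite quotient map.
data Contractions {n} (G : Graph (Fin n)) (P : Pred (Fin n) 0ℓ) :
                  ∀ {m} → Graph (Fin m) → (Fin n → Fin m) → Set₁ where
  done : Contractions G P G id
  step : ∀ {m l} {G′ : Graph (Fin m)} {H : Graph (Fin l)} {g f u v} →
         Contractions G P G′ g → P u → P v →
         IsNonedgeContraction G′ (g u) (g v) H f →
         Contractions G P H (f ∘ g)

Image : (V → W) → Pred V 0ℓ → Pred W 0ℓ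
Image f P b = ∃[ a ] P a × f a ≡ b

record IsVertexCompression {n m} (G : Graph (Fin n)) (w : Fin n)
                           (H : Graph (Fin m)) : Set₁ where
  field
    χ            : ℕ
    isChromatic  : IsChromaticNumber (induce G (ClosedNbhd G w)) χ
    quotient     : Fin n → Fin m
    contractions : Contractions G (ClosedNbhd G w) H quotient
    becomesK     : Spans (complete χ) H (Image quotient (ClosedNbhd G w))

{-# OPTIONS --safe #-}
module Submission where

-- Let N be the neighbourhood of w and R the set of vertices outside N ∪ {w}.
-- The quotient map q identifies only vertices of N, and K = q(N) is a clique.
-- The cycles of H, edges of G and vertices of H inject into the cycles of G,
-- edges of H and vertices of G, as follows.
--
-- Cycles of H.  One through q w is a triangle {q w, a, b} and goes to the edge
-- ab.  One meeting q(R) but not q w contains at most two vertices of K, which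
-- are consecutive; it lifts to an induced cycle of G, possibly with a detour
-- through w, whose vertices other than w map onto it.  One inside K is a
-- triangle; those go to induced cycles inside N, since a graph that is not
-- k-colourable has at least (k+1 choose 3) induced cycles: in a critical
-- subgraph, Kempe chains give an induced cycle through the critical vertex for
-- every pair of colours.
--
-- Edges and vertices.  For y outside N fix in every class a representative
-- adjacent to y where there is one.  A vertex of H goes to the representative of
-- its class for w.  An edge of G between a representative for y and y goes to
-- its image in H; an edge between w and another vertex u of N goes to u; an edge
-- between another vertex u of N and y ∈ R goes to the 4-cycle formed by u, y,
-- the representative for y in the class of u, and w; an edge uv inside N goes to
-- the triangle {u, v, w}.

open import Defs
open import Data.Empty using (⊥; ⊥-elim)
open import Data.Unit.Base using (⊤; tt)
open import Data.Nat.Base using (ℕ; zero; suc; _+_; _<_; _≤_; s≤s; z≤n; s<s; z<s; s≤s⁻¹; s<s⁻¹)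
import Data.Nat.Properties as ℕ
import Data.Integer.Base as ℤ
import Data.Integer.Properties as ℤ
open import Data.Fin.Base as Fin using (Fin; zero; suc; toℕ; fromℕ<)
import Data.Fin.Properties as Fin
open import Data.Fin.Subset using (Subset; inside; outside; _∈_; _∉_; ⁅_⁆; _∪_; ∣_∣; _⊆_)
open import Data.Fin.Subset.Properties using (_∈?_; ⊆-antisym; x∈⁅x⁆; x∈⁅y⁆⇒x≡y; x∈p∪q⁻; x∈p∪q⁺; p⊂q⇒∣p∣<∣q∣; ∣p∣≤n; drop-there)
open import Data.List.Base as List using (List; length; allFin; cartesianProduct)
import Data.List.Properties as List
import Data.List.Membership.Propositional as ∈ᴸ
import Data.List.Membership.Propositional.Properties as ∈ᴸ
import Data.List.Relation.Unary.Any as Any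
import Data.List.Relation.Unary.Any.Properties as Any
import Data.List.Relation.Unary.AllPairs as AllPairs
import Data.List.Relation.Unary.All as All
open import Data.List.Relation.Unary.Unique.Propositional using (Unique)
import Data.List.Relation.Unary.Unique.Propositional.Properties as Unique
open import Data.Product.Base using (Σ; ∃-syntax; _×_; _,_; proj₁; proj₂)
open import Data.Sum.Base as Sum using (_⊎_; inj₁; inj₂; [_,_]′)
import Data.Sum.Properties as Sum
open import Data.Vec.Base as Vec using (lookup; tabulate; here; there)
import Data.Vec.Properties as Vec
open import Function.Base using (_∘_; id; case_of_)
open import Function.Bundles using (module Equivalence)
import Data.Integer.Solver as ℤ
open import Level using (0ℓ)
open import Relation.Binary.Definitions using (tri<; tri≈; tri>)
open import Relation.Binary.PropositionalEquality
open import Relation.Nullary using (¬_; Dec; yes; no; does; contradiction)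
open import Relation.Nullary.Decidable using (_×-dec_; _⊎-dec_; _→-dec_; ¬?; map′; decidable-stable; dec-true; dec-false)
open import Relation.Unary using (Pred; Decidable)

private variable
  V W : Set
  k l m n : ℕ

-- Induced paths and cycles as sequences of vertices.

fromPred : {P : Pred (Fin n) 0ℓ} → Decidable P → Subset n
fromPred P? = tabulate (does ∘ P?)

module _ {P : Pred (Fin n) 0ℓ} (P? : Decidable P) where

  ∈-fromPred⁺ : ∀ {x} → P x → x ∈ fromPred P?
  ∈-fromPred⁺ {x} p = Vec.lookup⇒[]= x _ (trans (Vec.lookup∘tabulate _ x) (dec-true (P? x) p))

  ∈-fromPred⁻ : ∀ {x} → x ∈ fromPred P? → P x
  ∈-fromPred⁻ {x} x∈ = decidable-stable (P? x) λ ¬p → case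
    trans (sym (trans (Vec.lookup∘tabulate _ x) (dec-false (P? x) ¬p))) (Vec.[]=⇒lookup x∈)
    of λ ()

-- Induced paths and cycles are listed by sequences ℕ → V of which only an
-- initial segment matters; this makes extension at the front definitional.
record PathOn (G : Graph V) (l : ℕ) (p : ℕ → V) : Set where
  field
    distinct    : ∀ {i j} → i < j → j < l → p i ≢ p j
    consecutive : ∀ {i} → suc i < l → Adj G (p i) (p (suc i))
    chordless   : ∀ {i j} → i < j → j < l → Adj G (p i) (p j) → suc i ≡ j

record CycleOn (G : Graph V) (k : ℕ) (p : ℕ → V) : Set where
  field
    distinct    : ∀ {i j} → i < j → j < 3 + k → p i ≢ p j
    consecutive : ∀ {i} → suc i < 3 + k → Adj G (p i) (p (suc i))
    closing     : Adj G (p (2 + k)) (p 0)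
    chordless   : ∀ {i j} → i < j → j < 3 + k → Adj G (p i) (p j) →
                  suc i ≡ j ⊎ (i ≡ 0 × j ≡ 2 + k)

infixr 5 _◃_
_◃_ : V → (ℕ → V) → ℕ → V
(x ◃ p) zero    = x
(x ◃ p) (suc i) = p i

module _ {G : Graph V} where

  singletonPath : ∀ {p} → PathOn G 1 p
  singletonPath = record
    { distinct    = λ { () (s≤s z≤n) }
    ; consecutive = λ { (s≤s ()) }
    ; chordless   = λ { () (s≤s z≤n) }
    }

  extend : ∀ {x p} → PathOn G l p → (∀ {i} → i < l → x ≢ p i) → Adj G x (p 0) →
           (∀ {i} → i < l → Adj G x (p i) → i ≡ 0) → PathOn G (suc l) (x ◃ p)
  extend {x = x} {p} path x∉p adj only = record
    { distinct    = distinct′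
    ; consecutive = consecutive′
    ; chordless   = chordless′
    }
    where
    open PathOn path
    distinct′ : ∀ {i j} → i < j → j < _ → (x ◃ p) i ≢ (x ◃ p) j
    distinct′ {zero}  {suc j} _   j<l = x∉p (s<s⁻¹ j<l)
    distinct′ {suc i} {suc j} i<j j<l = distinct (s<s⁻¹ i<j) (s<s⁻¹ j<l)
    consecutive′ : ∀ {i} → suc i < _ → Adj G ((x ◃ p) i) (p i)
    consecutive′ {zero}  _   = adj
    consecutive′ {suc i} i<l = consecutive (s<s⁻¹ i<l)
    chordless′ : ∀ {i j} → i < j → j < _ → Adj G ((x ◃ p) i) ((x ◃ p) j) → suc i ≡ j
    chordless′ {zero}  {suc j} _   j<l a = cong suc (sym (only (s<s⁻¹ j<l) a))
    chordless′ {suc i} {suc j} i<j j<l a = cong suc (chordless (s<s⁻¹ i<j) (s<s⁻¹ j<l) a)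

  close : ∀ {x p} → PathOn G (2 + k) p → (∀ {i} → i < 2 + k → x ≢ p i) →
          Adj G x (p 0) → Adj G x (p (1 + k)) →
          (∀ {i} → i < 2 + k → Adj G x (p i) → i ≡ 0 ⊎ i ≡ 1 + k) → CycleOn G k (x ◃ p)
  close {k = k} {x = x} {p} path x∉p first last only = record
    { distinct    = distinct′
    ; consecutive = consecutive′
    ; closing     = symm G last
    ; chordless   = chordless′
    }
    where
    open PathOn path
    distinct′ : ∀ {i j} → i < j → j < 3 + k → (x ◃ p) i ≢ (x ◃ p) j
    distinct′ {zero}  {suc j} _   j<l = x∉p (s<s⁻¹ j<l)
    distinct′ {suc i} {suc j} i<j j<l = distinct (s<s⁻¹ i<j) (s<s⁻¹ j<l)
    consecutive′ : ∀ {i} → suc i < 3 + k → Adj G ((x ◃ p) i) (p i)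
    consecutive′ {zero}  _   = first
    consecutive′ {suc i} i<l = consecutive (s<s⁻¹ i<l)
    chordless′ : ∀ {i j} → i < j → j < 3 + k → Adj G ((x ◃ p) i) ((x ◃ p) j) →
                 suc i ≡ j ⊎ (i ≡ 0 × j ≡ 2 + k)
    chordless′ {zero}  {suc j} _   j<l a =
      Sum.map (cong suc ∘ sym) (λ eq → refl , cong suc eq) (only (s<s⁻¹ j<l) a)
    chordless′ {suc i} {suc j} i<j j<l a = inj₁ (cong suc (chordless (s<s⁻¹ i<j) (s<s⁻¹ j<l) a))

  tailPath : ∀ {p} → PathOn G (suc l) p → PathOn G l (p ∘ suc)
  tailPath path = record
    { distinct    = λ i<j j<l → distinct (s<s i<j) (s<s j<l)
    ; consecutive = consecutive ∘ s<s
    ; chordless   = λ i<j j<l → ℕ.suc-injective ∘ chordless (s<s i<j) (s<s j<l)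
    }
    where
    open PathOn path

  -- The exceptional adjacent pair `(0, 2 + k)` of a cycle involves the vertex that is dropped, so
  -- what remains is an induced path.
  tailCycle : ∀ {p} → CycleOn G k p → PathOn G (2 + k) (p ∘ suc)
  tailCycle cyc = record
    { distinct    = λ i<j j<l → distinct (s<s i<j) (s<s j<l)
    ; consecutive = consecutive ∘ s<s
    ; chordless   = λ i<j j<l a → case chordless (s<s i<j) (s<s j<l) a of λ where
        (inj₁ eq) → ℕ.suc-injective eq
        (inj₂ (() , _))
    }
    where
    open CycleOn cyc

  -- The last vertex moves to the front. Without it the others form an induced path, because it
  -- belongs to the pair `(0, 2 + k)`, and it closes that path again from the other side.
  rotate : ∀ {p} → CycleOn G k p → CycleOn G k (p (2 + k) ◃ p)
  rotate {k = k} {p = p} cyc = close initial (λ i<l eq → distinct i<l ℕ.≤-refl (sym eq)) closing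
    (symm G (consecutive ℕ.≤-refl)) only
    where
    open CycleOn cyc
    initial : PathOn G (2 + k) p
    initial = record
      { distinct    = λ i<j j<l → distinct i<j (ℕ.m<n⇒m<1+n j<l)
      ; consecutive = consecutive ∘ ℕ.m<n⇒m<1+n
      ; chordless   = λ i<j j<l a → case chordless i<j (ℕ.m<n⇒m<1+n j<l) a of λ where
          (inj₁ eq)         → eq
          (inj₂ (_ , refl)) → contradiction j<l ℕ.1+n≰n
      }
    only : ∀ {i} → i < 2 + k → Adj G (p (2 + k)) (p i) → i ≡ 0 ⊎ i ≡ 1 + k
    only i<l a = Sum.swap (Sum.map ℕ.suc-injective proj₁ (chordless i<l ℕ.≤-refl (symm G a)))

record CycleIn (G : Graph (Fin n)) (S : Subset n) (k : ℕ) (p : ℕ → Fin n) : Set where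
  field
    isCycle : CycleOn G k p
    into    : ∀ {i} → i < 3 + k → p i ∈ S
    onto    : ∀ {x} → x ∈ S → ∃[ i ] i < 3 + k × p i ≡ x

  open CycleOn isCycle public

rotateIn : ∀ {G : Graph (Fin n)} {S p} → CycleIn G S k p → CycleIn G S k (p (2 + k) ◃ p)
rotateIn {k = k} {S = S} {p = p} cyc = record
  { isCycle = rotate isCycle
  ; into    = into′
  ; onto    = onto′ ∘ onto
  }
  where
  open CycleIn cyc
  into′ : ∀ {i} → i < 3 + k → (p (2 + k) ◃ p) i ∈ S
  into′ {zero}  _   = into ℕ.≤-refl
  into′ {suc i} i<l = into (ℕ.<-trans (ℕ.n<1+n _) i<l)
  onto′ : ∀ {x} → ∃[ i ] i < 3 + k × p i ≡ x → ∃[ i ] i < 3 + k × (p (2 + k) ◃ p) i ≡ x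
  onto′ (i , i<l , eq) with ℕ.m≤n⇒m<n∨m≡n i<l
  ... | inj₁ i<l′ = suc i , i<l′ , eq
  ... | inj₂ refl = 0 , z<s , eq

-- The junk value of clamp above the range is the top element.
clamp : ℕ → Fin (suc l)
clamp         zero    = zero
clamp {zero}  (suc i) = zero
clamp {suc l} (suc i) = suc (clamp i)

toℕ-clamp : ∀ {i} → i < suc l → toℕ (clamp {l} i) ≡ i
toℕ-clamp         {i = zero}  _         = refl
toℕ-clamp {zero}  {i = suc i} (s≤s ())
toℕ-clamp {suc l} {i = suc i} (s≤s i<l) = cong suc (toℕ-clamp i<l)

clamp-toℕ : (i : Fin (suc l)) → clamp (toℕ i) ≡ i
clamp-toℕ i = Fin.toℕ-injective (toℕ-clamp (Fin.toℕ<n i))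

module _ {G : Graph (Fin n)} where

  inducedCycle⇒sequence : ∀ {S} → IsInducedCycle G S → ∃[ k ] ∃[ p ] CycleIn G S k p
  inducedCycle⇒sequence {S} (k , e , iso) = k , p , record
    { isCycle = record
      { distinct    = λ i<j j<l eq → ℕ.<⇒≢ i<j (clamp-injective (ℕ.<-trans i<j j<l) j<l (injective eq))
      ; consecutive = λ i<l → preserves _ _ (inj₁ (inj₁
          (trans (cong suc (toℕ-clamp (ℕ.<-trans (ℕ.n<1+n _) i<l))) (sym (toℕ-clamp i<l)))))
      ; closing     = preserves _ _ (inj₁ (inj₂ (toℕ-clamp ℕ.≤-refl , refl)))
      ; chordless   = λ i<j j<l a → chordless (ℕ.<-trans i<j j<l) i<j j<l (reflects _ _ a)
      }
    ; into    = λ _ → into _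
    ; onto    = λ x∈ → let i , eq = onto x∈ in
                toℕ i , Fin.toℕ<n i , trans (cong (lookup e) (clamp-toℕ i)) eq
    }
    where
    open IsIsoOnto iso
    p : ℕ → Fin n
    p i = lookup e (clamp i)
    clamp-injective : ∀ {i j} → i < 3 + k → j < 3 + k → clamp {2 + k} i ≡ clamp j → i ≡ j
    clamp-injective i<l j<l eq = trans (sym (toℕ-clamp i<l)) (trans (cong toℕ eq) (toℕ-clamp j<l))
    chordless : ∀ {i j} → i < 3 + k → i < j → j < 3 + k → Adj (cycle k) (clamp i) (clamp j) →
                suc i ≡ j ⊎ (i ≡ 0 × j ≡ 2 + k)
    chordless i<l i<j j<l a rewrite toℕ-clamp i<l | toℕ-clamp j<l with a
    ... | inj₁ (inj₁ eq)          = inj₁ eq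
    ... | inj₁ (inj₂ (_ , refl))  = case i<j of λ ()
    ... | inj₂ (inj₁ refl)        = contradiction (ℕ.<-trans (ℕ.n<1+n _) i<j) (ℕ.n≮n _)
    ... | inj₂ (inj₂ (eq , eq′))  = inj₂ (eq′ , eq)

  cycle⇒inducedCycle : ∀ {p} → CycleOn G k p →
    ∃[ S ] IsInducedCycle G S × CycleIn G S k p
  cycle⇒inducedCycle {k} {p} cyc = S , (k , Vec.tabulate (p ∘ toℕ) , iso) , cycIn
    where
    open CycleOn cyc
    S? : Decidable (λ x → ∃[ i ] i < 3 + k × p i ≡ x)
    S? x = ℕ.anyUpTo? (λ i → p i Fin.≟ x) (3 + k)
    S = fromPred S?
    cycIn : CycleIn G S k p
    cycIn = record
      { isCycle = cyc
      ; into    = λ {i} i<l → ∈-fromPred⁺ S? (i , i<l , refl)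
      ; onto    = ∈-fromPred⁻ S?
      }
    e : Fin (3 + k) → Fin n
    e = lookup (Vec.tabulate (p ∘ toℕ))
    e≗ : ∀ i → e i ≡ p (toℕ i)
    e≗ = Vec.lookup∘tabulate (p ∘ toℕ)
    next : ∀ {i j} → Next k i j → Adj G (p (toℕ i)) (p (toℕ j))
    next {i} {j} (inj₁ eq) = subst (λ t → Adj G (p (toℕ i)) (p t)) eq
      (consecutive (subst (_< 3 + k) (sym eq) (Fin.toℕ<n j)))
    next (inj₂ (eq , eq′)) = subst₂ (λ s t → Adj G (p s) (p t)) (sym eq) (sym eq′) closing
    distinct′ : ∀ {i j} → p (toℕ i) ≡ p (toℕ j) → i ≡ j
    distinct′ {i} {j} eq with Fin.<-cmp i j
    ... | tri< i<j _ _ = contradiction eq (distinct i<j (Fin.toℕ<n j))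
    ... | tri≈ _ i≡j _ = i≡j
    ... | tri> _ _ j<i = contradiction (sym eq) (distinct j<i (Fin.toℕ<n i))
    reflects′ : ∀ {i j} → Adj G (p (toℕ i)) (p (toℕ j)) → Adj (cycle k) i j
    reflects′ {i} {j} a with Fin.<-cmp i j
    ... | tri< i<j _ _  = case chordless i<j (Fin.toℕ<n j) a of λ where
      (inj₁ eq)         → inj₁ (inj₁ eq)
      (inj₂ (eq , eq′)) → inj₂ (inj₂ (eq′ , eq))
    ... | tri≈ _ refl _ = ⊥-elim (irrefl G a)
    ... | tri> _ _ j<i  = case chordless j<i (Fin.toℕ<n i) (symm G a) of λ where
      (inj₁ eq)         → inj₂ (inj₁ eq)
      (inj₂ (eq , eq′)) → inj₁ (inj₂ (eq′ , eq))
    iso : IsIsoOnto (cycle k) G (_∈ S) e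
    iso = record
      { injective = λ {i} {j} eq → distinct′ (trans (sym (e≗ i)) (trans eq (e≗ j)))
      ; into      = λ i → subst (_∈ S) (sym (e≗ i)) (CycleIn.into cycIn (Fin.toℕ<n i))
      ; onto      = λ x∈ → let i , i<l , eq = CycleIn.onto cycIn x∈ in
                    fromℕ< i<l , trans (e≗ _) (trans (cong p (Fin.toℕ-fromℕ< i<l)) eq)
      ; preserves = λ i j a → subst₂ (Adj G) (sym (e≗ i)) (sym (e≗ j))
                    ([ next , symm G ∘ next ]′ a)
      ; reflects  = λ i j a → reflects′ (subst₂ (Adj G) (e≗ i) (e≗ j) a)
      }

-- Sequences of contractions as quotient maps.

-- A homomorphism that is surjective on vertices and on edges. In this form the property is closed
-- under composition, which carries it along a sequence of contractions.
record IsQuotient (G : Graph V) (H : Graph W) (q : V → W) : Set where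
  field
    surjective : ∀ y → ∃[ x ] q x ≡ y
    hom        : ∀ {x y} → Adj G x y → Adj H (q x) (q y)
    lift       : ∀ {a b} → Adj H a b → ∃[ x ] ∃[ y ] q x ≡ a × q y ≡ b × Adj G x y

-- Adjacency in `H` is specified separately at the merged vertex and away from it, so each claim
-- splits on whether an endpoint is `u` or `v`. An edge with both ends merged is impossible: in `G`
-- because `u` and `v` are nonadjacent, in `H` because it would be a loop.
contraction⇒quotient : ∀ {G : Graph (Fin n)} {H : Graph W} {f u v} →
                       IsNonedgeContraction G u v H f → IsQuotient G H f
contraction⇒quotient {n = n} {G = G} {H} {f} {u} {v} c = record
  { surjective = λ y → let x , eq = C.surjective y in x , eq refl
  ; hom        = hom
  ; lift       = lift
  }
  where
  module C = IsNonedgeContraction c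
  Merged : Pred (Fin n) 0ℓ
  Merged x = x ≡ u ⊎ x ≡ v
  merged? : Decidable Merged
  merged? x = (x Fin.≟ u) ⊎-dec (x Fin.≟ v)
  f-merged : ∀ {x} → Merged x → f u ≡ f x
  f-merged (inj₁ refl) = refl
  f-merged (inj₂ refl) = C.identified
  independent : ∀ {x y} → Merged x → Merged y → ¬ Adj G x y
  independent (inj₁ refl) (inj₁ refl) = irrefl G
  independent (inj₁ refl) (inj₂ refl) = C.nonadjacent
  independent (inj₂ refl) (inj₁ refl) = C.nonadjacent ∘ symm G
  independent (inj₂ refl) (inj₂ refl) = irrefl G
  fromMerged : ∀ {x y} → Merged x → Adj G x y → Adj G u y ⊎ Adj G v y
  fromMerged (inj₁ refl) = inj₁
  fromMerged (inj₂ refl) = inj₂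
  homMerged : ∀ {x y} → Merged x → ¬ Merged y → Adj G x y → Adj H (f x) (f y)
  homMerged {y = y} x∈ y∉ a = subst (λ z → Adj H z (f y)) (f-merged x∈)
    (Equivalence.from (C.adj-merged (y∉ ∘ inj₁) (y∉ ∘ inj₂)) (fromMerged x∈ a))
  hom : ∀ {x y} → Adj G x y → Adj H (f x) (f y)
  hom {x} {y} a with merged? x | merged? y
  ... | yes x∈ | yes y∈ = contradiction a (independent x∈ y∈)
  ... | yes x∈ | no  y∉ = homMerged x∈ y∉ a
  ... | no  x∉ | yes y∈ = symm H (homMerged y∈ x∉ (symm G a))
  ... | no  x∉ | no  y∉ = Equivalence.from
    (C.adj-others (x∉ ∘ inj₁) (x∉ ∘ inj₂) (y∉ ∘ inj₁) (y∉ ∘ inj₂)) a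
  liftMerged : ∀ {x y} → Merged x → ¬ Merged y → Adj H (f x) (f y) → ∃[ x′ ] f x′ ≡ f x × Adj G x′ y
  liftMerged {x} {y} x∈ y∉ a = case
    Equivalence.to (C.adj-merged (y∉ ∘ inj₁) (y∉ ∘ inj₂))
      (subst (λ z → Adj H z (f y)) (sym (f-merged x∈)) a) of λ where
    (inj₁ b) → u , f-merged x∈ , b
    (inj₂ b) → v , trans (sym C.identified) (f-merged x∈) , b
  lift : ∀ {a b} → Adj H a b → ∃[ x ] ∃[ y ] f x ≡ a × f y ≡ b × Adj G x y
  lift {a} {b} adj with C.surjective a | C.surjective b
  ... | x , fx | y , fy with fx refl | fy refl
  ... | refl | refl with merged? x | merged? y
  ... | yes x∈ | yes y∈ = ⊥-elim (irrefl H
          (subst₂ (Adj H) (sym (f-merged x∈)) (sym (f-merged y∈)) adj))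
  ... | yes x∈ | no  y∉ = let x′ , eq , e = liftMerged x∈ y∉ adj in x′ , y , eq , refl , e
  ... | no  x∉ | yes y∈ = let y′ , eq , e = liftMerged y∈ x∉ (symm H adj) in
          x , y′ , refl , eq , symm G e
  ... | no  x∉ | no  y∉ = x , y , refl , refl , Equivalence.to
    (C.adj-others (x∉ ∘ inj₁) (x∉ ∘ inj₂) (y∉ ∘ inj₁) (y∉ ∘ inj₂)) adj

module _ {G : Graph (Fin n)} {P : Pred (Fin n) 0ℓ} where

  contractions⇒quotient : ∀ {H : Graph (Fin m)} {q} → Contractions G P H q → IsQuotient G H q
  contractions⇒quotient done = record
    { surjective = λ y → y , refl
    ; hom        = id
    ; lift       = λ a → _ , _ , refl , refl , a
    }
  contractions⇒quotient (step {f = f} {u} {v} cs _ _ c) = record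
    { surjective = λ y → let x , fx≡y = F.surjective y ; z , gz≡x = Q.surjective x in
                   z , trans (cong f gz≡x) fx≡y
    ; hom        = F.hom ∘ Q.hom
    ; lift       = λ a → let x , y , fx , fy , b = F.lift a ; x′ , y′ , gx , gy , c = Q.lift b in
                   x′ , y′ , trans (cong f gx) fx , trans (cong f gy) fy , c
    }
    where
    module Q = IsQuotient (contractions⇒quotient cs)
    module F = IsQuotient (contraction⇒quotient c)

  contractions-kernel : ∀ {H : Graph (Fin m)} {q} → Contractions G P H q →
                        ∀ {x y} → q x ≡ q y → x ≡ y ⊎ (P x × P y)
  contractions-kernel done eq = inj₁ eq
  contractions-kernel (step {g = g} cs Pu Pv c) eq with IsNonedgeContraction.only c eq
  ... | inj₁ gx≡gy = contractions-kernel cs gx≡gy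
  ... | inj₂ both  = inj₂ ([ (λ (x , y) → P-class Pu x , P-class Pv y)
                           , (λ (x , y) → P-class Pv x , P-class Pu y) ]′ both)
    where
    -- A newly merged class is the union of the classes of `u` and `v`. By induction each of these
    -- lies in `P`, since it contains a point of `P`.
    P-class : ∀ {x y} → P y → g x ≡ g y → P x
    P-class Py eq with contractions-kernel cs eq
    ... | inj₁ refl     = Py
    ... | inj₂ (Px , _) = Px

-- Induced paths between two vertex sets inside a region.

module _ (G : Graph (Fin n)) {U A B : Pred (Fin n) 0ℓ}
         (U? : Decidable U) (A? : Decidable A) (B? : Decidable B) (B⊆U : ∀ {v} → B v → U v) where

  data Reach : Pred (Fin n) 0ℓ where
    start : ∀ {v} → B v → Reach v
    step  : ∀ {u v} → Reach u → Adj G u v → U v → Reach v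

  reach⊆U : ∀ {v} → Reach v → U v
  reach⊆U (start b)    = B⊆U b
  reach⊆U (step _ _ u) = u

  -- The reachable vertices are collected in a `Subset` so that membership is decidable, which the
  -- recolouring along Kempe chains relies on.
  record Closure : Set where
    field
      members   : Subset n
      reachable : ∀ {v} → v ∈ members → Reach v
      initial   : ∀ {v} → B v → v ∈ members
      closed    : ∀ {u v} → u ∈ members → Adj G u v → U v → v ∈ members

  closure : Closure
  closure = grow n (fromPred B?) (ℕ.m≤m+n n _) (start ∘ ∈-fromPred⁻ B?) (∈-fromPred⁺ B?)
    where
    -- The fuel bounds the number of vertices missing from `C`, and each round adds one. At zero
    -- fuel a further vertex would give a subset with more than `n` elements.
    grow : ∀ fuel (C : Subset n) → n ≤ fuel + ∣ C ∣ → (∀ {v} → v ∈ C → Reach v) →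
           (∀ {v} → B v → v ∈ C) → Closure
    grow fuel C enough sound B⊆C
      with Fin.any? (λ u → Fin.any? λ v → (u ∈? C) ×-dec adj? G u v ×-dec U? v ×-dec ¬? (v ∈? C))
    ... | no saturated = record
      { members   = C
      ; reachable = sound
      ; initial   = B⊆C
      ; closed    = λ {u} {v} u∈ a Uv → decidable-stable (v ∈? C) λ v∉ → saturated (u , v , u∈ , a , Uv , v∉)
      }
    ... | yes (u , v , u∈ , a , Uv , v∉) = continue fuel enough
      where
      C′ = C ∪ ⁅ v ⁆
      larger : ∣ C ∣ < ∣ C′ ∣
      larger = p⊂q⇒∣p∣<∣q∣ ((λ x∈ → x∈p∪q⁺ (inj₁ x∈)) , v , x∈p∪q⁺ (inj₂ (x∈⁅x⁆ v)) , v∉)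
      continue : ∀ fuel → n ≤ fuel + ∣ C ∣ → Closure
      continue zero    n≤ = contradiction (ℕ.≤-trans (ℕ.<-≤-trans larger (∣p∣≤n C′)) n≤) (ℕ.n≮n _)
      continue (suc f) n≤ = grow f C′
        (ℕ.≤-trans n≤ (subst (_≤ f + ∣ C′ ∣) (ℕ.+-suc f ∣ C ∣) (ℕ.+-monoʳ-≤ f larger)))
        (λ x∈ → case x∈p∪q⁻ C ⁅ v ⁆ x∈ of λ where
          (inj₁ x∈C) → sound x∈C
          (inj₂ x∈v) → subst Reach (sym (x∈⁅y⁆⇒x≡y v x∈v)) (step (sound u∈) a Uv))
        (λ b → x∈p∪q⁺ (inj₁ (B⊆C b)))

  -- By `early` and `late` the path meets `B` only at its end and `A` at most at its start. A
  -- further vertex whose neighbours in `U` all lie in `A` or `B` can thus be adjacent only to the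
  -- two ends.
  record Chain (v : Fin n) : Set where
    field
      len   : ℕ
      seq   : ℕ → Fin n
      path  : PathOn G (suc len) seq
      first : seq 0 ≡ v
      last  : B (seq len)
      early : ∀ {i} → i < len → ¬ B (seq i)
      late  : ∀ {i} → 0 < i → i ≤ len → ¬ A (seq i)
      all   : ∀ {i} → i ≤ len → U (seq i)

  trivialChain : ∀ {v} → B v → Chain v
  trivialChain {v} b = record
    { len = 0 ; seq = λ _ → v ; path = singletonPath ; first = refl ; last = b
    ; early = λ () ; late = λ 0<i i≤0 → contradiction (ℕ.<-≤-trans 0<i i≤0) (ℕ.n≮n 0)
    ; all = λ _ → B⊆U b
    }

  -- Leaving the path at the last vertex equal or adjacent to v keeps it induced.
  shortcut : ∀ {v} → U v → ¬ B v → ∀ len (p : ℕ → Fin n) → PathOn G (suc len) p → B (p len) →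
             (∀ {i} → i < len → ¬ B (p i)) → (∀ {i} → i ≤ len → ¬ A (p i)) →
             (∀ {i} → i ≤ len → U (p i)) → ∃[ i ] i ≤ len × (v ≡ p i ⊎ Adj G v (p i)) → Chain v
  shortcut {v} Uv ¬Bv len p path last early ¬A all (j , j≤ , touch)
    with ℕ.anyUpTo? (λ i → (v Fin.≟ p (suc i)) ⊎-dec adj? G v (p (suc i))) len
  shortcut {v} Uv ¬Bv (suc len) p path last early ¬A all _ | yes (i , i<l , touch) =
    shortcut Uv ¬Bv len (p ∘ suc) (tailPath path) last (early ∘ s<s) (¬A ∘ s≤s) (all ∘ s≤s)
      (i , s≤s⁻¹ i<l , touch)
  shortcut {v} Uv ¬Bv len p path last early ¬A all (suc j , j≤ , touch) | no none =
    contradiction (j , j≤ , touch) none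
  shortcut {v} Uv ¬Bv len p path last early ¬A all (zero , _ , inj₁ v≡) | no none = record
    { len = len ; seq = p ; path = path ; first = sym v≡ ; last = last ; early = early
    ; late = λ _ → ¬A ; all = all }
  shortcut {v} Uv ¬Bv len p path last early ¬A all (zero , _ , inj₂ a) | no none = record
    { len = suc len ; seq = v ◃ p ; path = extend path v∉ a only ; first = refl ; last = last
    ; early = λ { {zero} _ → ¬Bv ; {suc i} i<l → early (s<s⁻¹ i<l) }
    ; late = λ { {suc i} _ i≤l → ¬A (s≤s⁻¹ i≤l) }
    ; all = λ { {zero} _ → Uv ; {suc i} i≤l → all (s≤s⁻¹ i≤l) }
    }
    where
    v∉ : ∀ {i} → i < suc len → v ≢ p i
    v∉ {zero}  _   eq = irrefl G (subst (Adj G v) (sym eq) a)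
    v∉ {suc i} i<l eq = none (i , s<s⁻¹ i<l , inj₁ eq)
    only : ∀ {i} → i < suc len → Adj G v (p i) → i ≡ 0
    only {zero}  _   _  = refl
    only {suc i} i<l a′ = contradiction (i , s<s⁻¹ i<l , inj₂ a′) none

  CrossChain : Set
  CrossChain = ∃[ v ] A v × Chain v

  -- The induction stops at the first vertex of `A` that it meets. Until then the chain built so far
  -- avoids `A` altogether, so the next vertex can be attached to it by `shortcut`.
  reach⇒chain : ∀ {v} → Reach v → CrossChain ⊎ Chain v
  reach⇒chain (start b) = inj₂ (trivialChain b)
  reach⇒chain (step {u} {v} r adj Uv) with reach⇒chain r
  ... | inj₁ found = inj₁ found
  ... | inj₂ ch with A? u | B? v
  ...   | yes Au | _      = inj₁ (u , Au , ch)
  ...   | no  _  | yes Bv = inj₂ (trivialChain Bv)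
  ...   | no ¬Au | no ¬Bv = inj₂ (shortcut Uv ¬Bv len seq path last early ¬A all
          (0 , z≤n , inj₂ (symm G (subst (λ z → Adj G z v) (sym first) adj))))
    where
    open Chain ch
    ¬A : ∀ {i} → i ≤ len → ¬ A (seq i)
    ¬A {zero}  _   = subst (¬_ ∘ A) (sym first) ¬Au
    ¬A {suc i} i≤l = late z<s i≤l

  crossing : ∀ {v} → Reach v → A v → CrossChain
  crossing r a with reach⇒chain r
  ... | inj₁ found = found
  ... | inj₂ ch    = _ , a , ch

-- Partial colourings and Kempe cycles through a critical vertex.

-- Colourings are total functions that are proper on `Q` only, so `Q` can grow or shrink without a
-- change of type.
ProperOn : Graph V → Pred V 0ℓ → (V → Fin k) → Set
ProperOn G Q c = ∀ {u v} → Q u → Q v → Adj G u v → c u ≢ c v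

ColourableOn : Graph V → Pred V 0ℓ → ℕ → Set
ColourableOn {V} G Q k = Σ (V → Fin k) (ProperOn G Q)

module _ (G : Graph (Fin n)) where

  colourableOn-⊆ : ∀ {P Q : Pred (Fin n) 0ℓ} → (∀ {v} → P v → Q v) →
                   ColourableOn G Q k → ColourableOn G P k
  colourableOn-⊆ P⊆Q (c , proper) = c , λ Pu Pv → proper (P⊆Q Pu) (P⊆Q Pv)

  colourableOn? : ∀ {Q : Pred (Fin n) 0ℓ} → Decidable Q → ∀ k → Dec (ColourableOn G Q k)
  colourableOn? {Q} Q? k = map′
    (λ (c , proper) → lookup c , λ {u} {v} → proper u v)
    (λ (c , proper) → tabulate c , λ u v Qu Qv a eq → proper Qu Qv a
      (trans (sym (Vec.lookup∘tabulate c u)) (trans eq (Vec.lookup∘tabulate c v))))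
    (anyVec? n λ c → Fin.all? λ u → Fin.all? λ v →
      Q? u →-dec Q? v →-dec adj? G u v →-dec ¬? (lookup c u Fin.≟ lookup c v))

  freshColour : ∀ {Q : Pred (Fin n) 0ℓ} {x} → ColourableOn G Q k →
                ColourableOn G (λ v → v ≡ x ⊎ Q v) (suc k)
  freshColour {k} {Q} {x} (c , proper) =
    (λ v → colour v (v Fin.≟ x)) , λ {u} {v} Qu Qv → ok Qu Qv (u Fin.≟ x) (v Fin.≟ x)
    where
    colour : ∀ v → Dec (v ≡ x) → Fin (suc k)
    colour v (yes _) = zero
    colour v (no _)  = suc (c v)
    ok : ∀ {u v} → u ≡ x ⊎ Q u → v ≡ x ⊎ Q v → (du : Dec (u ≡ x)) (dv : Dec (v ≡ x)) →
         Adj G u v → colour u du ≢ colour v dv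
    ok _ _ (yes refl) (yes refl) a _ = irrefl G a
    ok Qu Qv (no u≢) (no v≢) a eq with Qu | Qv
    ... | inj₁ u≡ | _       = u≢ u≡
    ... | inj₂ _  | inj₁ v≡ = v≢ v≡
    ... | inj₂ q  | inj₂ q′ = proper q q′ a (Fin.suc-injective eq)

  module _ {Q : Pred (Fin n) 0ℓ} (Q? : Decidable Q) {x : Fin n} (x∉Q : ¬ Q x)
           {c : Fin n → Fin k} (proper : ProperOn G Q c)
           (¬colourable : ¬ ColourableOn G (λ v → v ≡ x ⊎ Q v) k) where

    -- Both colours have to occur on `S` away from `x`, so that `S` determines the unordered pair of
    -- `i` and `j`.
    KempeCycle : (i j : Fin k) → Set
    KempeCycle i j = ∃[ S ] IsInducedCycle G S × x ∈ S ×
      (∀ {v} → v ∈ S → v ≢ x → Q v × (c v ≡ i ⊎ c v ≡ j)) ×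
      (∃[ v ] v ∈ S × v ≢ x × c v ≡ i) × (∃[ v ] v ∈ S × v ≢ x × c v ≡ j)

    -- If no Kempe chain joined an i-coloured and a j-coloured neighbour of x, swapping
    -- the two colours on the chains at the j-coloured ones would free j for x.
    kempeCycle : ∀ {i j} → i ≢ j → KempeCycle i j
    kempeCycle {i} {j} i≢j = fromCross cross
      where
      U A B : Pred (Fin n) 0ℓ
      U v = Q v × (c v ≡ i ⊎ c v ≡ j)
      A v = Q v × c v ≡ i × Adj G x v
      B v = Q v × c v ≡ j × Adj G x v
      U? : Decidable U
      U? v = Q? v ×-dec ((c v Fin.≟ i) ⊎-dec (c v Fin.≟ j))
      A? : Decidable A
      A? v = Q? v ×-dec (c v Fin.≟ i) ×-dec adj? G x v
      B? : Decidable B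
      B? v = Q? v ×-dec (c v Fin.≟ j) ×-dec adj? G x v
      B⊆U : ∀ {v} → B v → U v
      B⊆U (Qv , eq , _) = Qv , inj₂ eq
      open Closure (closure G U? A? B? B⊆U) renaming (members to C)
      swapped : ∀ {t} → Dec (t ≡ i) → Fin k
      swapped (yes _) = j
      swapped (no _)  = i
      swapped-ij : ∀ {t} (d : Dec (t ≡ i)) → swapped d ≡ i ⊎ swapped d ≡ j
      swapped-ij (yes _) = inj₂ refl
      swapped-ij (no _)  = inj₁ refl
      colour : ∀ v → Dec (v ≡ x) → Dec (v ∈ C) → Fin k
      colour v (yes _) _       = j
      colour v (no _)  (yes _) = swapped (c v Fin.≟ i)
      colour v (no _)  (no _)  = c v
      C-ij : ∀ {v} → v ∈ C → c v ≡ i ⊎ c v ≡ j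
      C-ij = proj₂ ∘ reach⊆U G U? A? B? B⊆U ∘ reachable
      module _ (separated : ∀ {v} → v ∈ C → ¬ A v) where
        ok-x : ∀ {v} → Q v → Adj G x v → ∀ dv dC → j ≢ colour v dv dC
        ok-x Qv a (yes refl) _        _  = irrefl G a
        ok-x {v} Qv a (no _) (yes v∈) eq with c v Fin.≟ i
        ... | yes cv≡i = separated v∈ (Qv , cv≡i , a)
        ... | no  _    = i≢j (sym eq)
        ok-x Qv a (no _) (no v∉) eq = v∉ (initial (Qv , sym eq , a))
        -- The new colour of `u` is `i` or `j`. If `v` had the same colour it would belong to `U`,
        -- and then to `C`, because `C` is closed.
        ok-mixed : ∀ {u v} → u ∈ C → v ∉ C → Q v → Adj G u v → swapped (c u Fin.≟ i) ≢ c v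
        ok-mixed {u} u∈ v∉ Qv a eq = v∉ (closed u∈ a (Qv , subst (λ t → t ≡ i ⊎ t ≡ j) eq
          (swapped-ij (c u Fin.≟ i))))
        ok : ∀ {u v} → u ≡ x ⊎ Q u → v ≡ x ⊎ Q v → Adj G u v → ∀ du dC dv dC′ →
             colour u du dC ≢ colour v dv dC′
        ok _ (inj₁ v≡) a (yes refl) dC dv dC′ = λ _ → irrefl G (subst (Adj G x) v≡ a)
        ok _ (inj₂ Qv) a (yes refl) dC dv dC′ = ok-x Qv a dv dC′
        ok (inj₁ u≡) _ a (no u≢) dC dv dC′ = λ _ → u≢ u≡
        ok (inj₂ Qu) _ a (no u≢) dC (yes refl) dC′ = ok-x Qu (symm G a) (no u≢) dC ∘ sym
        ok (inj₂ Qu) (inj₁ v≡) a (no u≢) dC (no v≢) dC′ = λ _ → v≢ v≡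
        ok {u} {v} (inj₂ Qu) (inj₂ Qv) a (no _) (yes u∈) (no _) (yes v∈) eq
          with c u Fin.≟ i | c v Fin.≟ i
        ... | yes cu | yes cv = proper Qu Qv a (trans cu (sym cv))
        ... | yes _  | no _   = i≢j (sym eq)
        ... | no _   | yes _  = i≢j eq
        ... | no cu  | no cv  = proper Qu Qv a (trans (isj u∈ cu) (sym (isj v∈ cv)))
          where
          isj : ∀ {w} → w ∈ C → c w ≢ i → c w ≡ j
          isj w∈ ≢i = [ ⊥-elim ∘ ≢i , id ]′ (C-ij w∈)
        ok (inj₂ Qu) (inj₂ Qv) a (no _) (yes u∈) (no _) (no v∉) eq = ok-mixed u∈ v∉ Qv a eq
        ok (inj₂ Qu) (inj₂ Qv) a (no _) (no u∉) (no _) (yes v∈) eq =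
          ok-mixed v∈ u∉ Qu (symm G a) (sym eq)
        ok (inj₂ Qu) (inj₂ Qv) a (no _) (no _) (no _) (no _) eq = proper Qu Qv a eq
        recoloured : ColourableOn G (λ v → v ≡ x ⊎ Q v) k
        recoloured = (λ v → colour v (v Fin.≟ x) (v ∈? C)) ,
          λ Qu Qv a → ok Qu Qv a (_ Fin.≟ x) (_ ∈? C) (_ Fin.≟ x) (_ ∈? C)
      cross : CrossChain G U? A? B? B⊆U
      cross with Fin.any? (λ v → (v ∈? C) ×-dec A? v)
      ... | yes (v , v∈ , Av) = crossing G U? A? B? B⊆U (reachable v∈) Av
      ... | no none = ⊥-elim (¬colourable (recoloured λ v∈ Av → none (_ , v∈ , Av)))
      fromCross : CrossChain G U? A? B? B⊆U → KempeCycle i j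
      fromCross (v , Av , record { len = zero ; first = refl ; last = last }) =
        contradiction (trans (sym (proj₁ (proj₂ Av))) (proj₁ (proj₂ last))) i≢j
      fromCross (v , Av , record { len = suc l ; seq = p ; path = path ; first = refl ; last = last
                                 ; early = early ; late = late ; all = all }) =
        S , isCyc , into z<s , (λ {v} → inside-U {v})
        , (p 0 , into (s<s z<s) , ≢x z≤n , proj₁ (proj₂ Av))
        , (p (suc l) , into ℕ.≤-refl , ≢x ℕ.≤-refl , proj₁ (proj₂ last))
        where
        ≢x : ∀ {t} → t ≤ suc l → p t ≢ x
        ≢x t≤ eq = x∉Q (subst Q eq (proj₁ (all t≤)))
        -- A neighbour of `x` on the chain has colour `i` or `j`, hence lies in `A` or in `B`;
        -- `late` leaves only the start for `A` and `early` only the end for `B`.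
        only : ∀ {t} → t < 2 + l → Adj G x (p t) → t ≡ 0 ⊎ t ≡ 1 + l
        only {zero}  _  _ = inj₁ refl
        only {suc t} t< a with all (s≤s⁻¹ t<)
        ... | Qp , inj₁ ≡i = contradiction (Qp , ≡i , a) (late z<s (s≤s⁻¹ t<))
        ... | Qp , inj₂ ≡j with ℕ.m≤n⇒m<n∨m≡n (s≤s⁻¹ t<)
        ...   | inj₁ lt = contradiction (Qp , ≡j , a) (early lt)
        ...   | inj₂ eq = inj₂ eq
        result = cycle⇒inducedCycle (close path (λ t< eq → ≢x (s≤s⁻¹ t<) (sym eq))
          (proj₂ (proj₂ Av)) (proj₂ (proj₂ last)) only)
        S = proj₁ result
        isCyc = proj₁ (proj₂ result)
        open CycleIn (proj₂ (proj₂ result)) using (into; onto)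
        inside-U : ∀ {v} → v ∈ S → v ≢ x → U v
        inside-U v∈ v≢x with onto v∈
        ... | zero  , _  , eq   = contradiction (sym eq) v≢x
        ... | suc t , t< , refl = all (s≤s⁻¹ (s<s⁻¹ t<))

-- Triples of colours coded by induced cycles.

record Triple (T : Subset k) (a b c : Fin k) : Set where
  constructor triple
  field
    a≢b : a ≢ b
    a≢c : a ≢ c
    b≢c : b ≢ c
    a∈  : a ∈ T
    b∈  : b ∈ T
    c∈  : c ∈ T
    onto : ∀ {i} → i ∈ T → i ≡ a ⊎ i ≡ b ⊎ i ≡ c

IsTriple : Subset k → Set
IsTriple T = ∃[ a ] ∃[ b ] ∃[ c ] Triple T a b c

IsPair : Subset k → Set
IsPair T = ∃[ a ] ∃[ b ] a ≢ b × a ∈ T × b ∈ T × (∀ {i} → i ∈ T → i ≡ a ⊎ i ≡ b)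

rotateTriple : ∀ {T : Subset k} {a b c} → Triple T a b c → Triple T b c a
rotateTriple (triple a≢b a≢c b≢c a∈ b∈ c∈ onto) =
  triple b≢c (a≢b ∘ sym) (a≢c ∘ sym) b∈ c∈ a∈ λ i∈ → case onto i∈ of λ where
    (inj₁ eq)        → inj₂ (inj₂ eq)
    (inj₂ (inj₁ eq)) → inj₁ eq
    (inj₂ (inj₂ eq)) → inj₂ (inj₁ eq)

tail-pair : ∀ {T : Subset k} → IsTriple (inside Vec.∷ T) → IsPair T
tail-pair {T = T} (a , b , c , t) = case Triple.onto t here of λ where
    (inj₁ refl)        → remaining t
    (inj₂ (inj₁ refl)) → remaining (rotateTriple t)
    (inj₂ (inj₂ refl)) → remaining (rotateTriple (rotateTriple t))
  where
  remaining : ∀ {b c} → Triple (inside Vec.∷ T) zero b c → IsPair T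
  remaining {zero}          t = contradiction refl (Triple.a≢b t)
  remaining {suc b} {zero}  t = contradiction refl (Triple.a≢c t)
  remaining {suc b} {suc c} (triple _ _ b≢c _ b∈ c∈ onto) =
    b , c , b≢c ∘ cong suc , drop-there b∈ , drop-there c∈ , λ i∈ → case onto (there i∈) of λ where
      (inj₂ (inj₁ refl)) → inj₁ refl
      (inj₂ (inj₂ refl)) → inj₂ refl

tail-triple : ∀ {T : Subset k} → IsTriple (outside Vec.∷ T) → IsTriple T
tail-triple (suc a , suc b , suc c , triple a≢b a≢c b≢c a∈ b∈ c∈ onto) = a , b , c ,
  triple (a≢b ∘ cong suc) (a≢c ∘ cong suc) (b≢c ∘ cong suc)
    (drop-there a∈) (drop-there b∈) (drop-there c∈) λ i∈ → case onto (there i∈) of λ where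
      (inj₁ refl)        → inj₁ refl
      (inj₂ (inj₁ refl)) → inj₂ (inj₁ refl)
      (inj₂ (inj₂ refl)) → inj₂ (inj₂ refl)
tail-triple (zero , _ , _ , t)          = case Triple.a∈ t of λ ()
tail-triple (suc _ , zero , _ , t)      = case Triple.b∈ t of λ ()
tail-triple (suc _ , suc _ , zero , t)  = case Triple.c∈ t of λ ()

-- This amounts to at least `k` choose 3 induced cycles inside `Q`. `Codes` is a relation, so
-- `injective` says that the colours can be read off from the vertex set alone, however the cycle
-- was found.
record TripleCoding (G : Graph (Fin n)) (Q : Pred (Fin n) 0ℓ) (k : ℕ) : Set₁ where
  field
    Codes     : Subset k → Subset n → Set
    total     : ∀ {T} → IsTriple T → ∃[ S ] Codes T S
    valid     : ∀ {T S} → Codes T S → IsInducedCycle G S × (∀ {v} → v ∈ S → Q v)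
    injective : ∀ {T T′ S} → Codes T S → Codes T′ S → T ≡ T′

-- Applied to initial segments of the vertex set, this finds a vertex whose addition destroys
-- colourability.
firstFailure : ∀ {P : Pred ℕ 0ℓ} → Decidable P → P 0 → ∀ n → ¬ P n → ∃[ t ] t < n × P t × ¬ P (suc t)
firstFailure P? P0 zero    ¬Pn = contradiction P0 ¬Pn
firstFailure P? P0 (suc n) ¬P  with P? n
... | yes Pn = n , ℕ.≤-refl , Pn , ¬P
... | no ¬Pn = let t , t<n , p = firstFailure P? P0 n ¬Pn in t , ℕ.m<n⇒m<1+n t<n , p

-- Triples avoiding colour zero are coded by induction in the graph without a
-- critical vertex x; the others are coded by Kempe cycles through x.
chromaticTriples : (G : Graph (Fin n)) {Q : Pred (Fin n) 0ℓ} → Decidable Q → ∀ k →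
                   ¬ ColourableOn G Q k → TripleCoding G Q (suc k)
chromaticTriples G Q? zero ¬colourable = record
  { Codes     = λ _ _ → ⊥
  ; total     = λ { (zero , zero , _ , t) → contradiction refl (Triple.a≢b t) }
  ; valid     = λ ()
  ; injective = λ ()
  }
chromaticTriples {n} G {Q} Q? (suc k) ¬colourable = record
  { Codes     = Codes
  ; total     = total
  ; valid     = λ {T} → valid {T}
  ; injective = injective
  }
  where
  Below : ℕ → Pred (Fin n) 0ℓ
  Below t v = Q v × toℕ v < t
  Below? : ∀ t → Decidable (Below t)
  Below? t v = Q? v ×-dec (toℕ v ℕ.<? t)
  -- `Below t` is colourable with `suc k` colours and `Below (suc t)` is not, so the vertex numbered
  -- `t` is the critical one.
  critical = firstFailure {P = λ t → ColourableOn G (Below t) (suc k)}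
    (λ t → colourableOn? G (Below? t) (suc k))
    ((λ _ → zero) , λ { (_ , ()) }) n
    (¬colourable ∘ colourableOn-⊆ G λ {v} Qv → Qv , Fin.toℕ<n v)
  t   = proj₁ critical
  t<n = proj₁ (proj₂ critical)
  c   = proj₁ (proj₁ (proj₂ (proj₂ critical)))
  proper : ProperOn G (Below t) c
  proper = proj₂ (proj₁ (proj₂ (proj₂ critical)))
  ¬next : ¬ ColourableOn G (Below (suc t)) (suc k)
  ¬next = proj₂ (proj₂ (proj₂ critical))
  x : Fin n
  x = fromℕ< t<n
  toℕ-x : toℕ x ≡ t
  toℕ-x = Fin.toℕ-fromℕ< t<n
  x∉ : ¬ Below t x
  x∉ (_ , x<t) = ℕ.n≮n t (subst (_< t) toℕ-x x<t)
  split : ∀ {v} → Below (suc t) v → v ≡ x ⊎ Below t v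
  split (Qv , v<) with ℕ.m≤n⇒m<n∨m≡n (s≤s⁻¹ v<)
  ... | inj₁ v<t = inj₂ (Qv , v<t)
  ... | inj₂ eq  = inj₁ (Fin.toℕ-injective (trans eq (sym toℕ-x)))
  Qx : Q x
  Qx = decidable-stable (Q? x) λ ¬Qx → ¬next (colourableOn-⊆ G
    (λ b → case split b of λ where
      (inj₁ refl) → contradiction (proj₁ b) ¬Qx
      (inj₂ b′)   → b′) (c , proper))
  ¬extended : ¬ ColourableOn G (λ v → v ≡ x ⊎ Below t v) (suc k)
  ¬extended = ¬next ∘ colourableOn-⊆ G split
  -- A colouring of `Below t` with `k` colours and a fresh colour for `x` would colour
  -- `Below (suc t)` with `suc k` colours. The induction hypothesis therefore applies to `Below t`.
  open TripleCoding (chromaticTriples G (Below? t) k (¬extended ∘ freshColour G))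
    renaming (Codes to Codes₀; total to total₀; valid to valid₀; injective to injective₀)
  ColourOf : Subset n → Fin (suc k) → Set
  ColourOf S i = ∃[ v ] v ∈ S × v ≢ x × c v ≡ i
  -- Colour zero marks the cycles through `x`. For these, `T` is exactly the set of colours that `c`
  -- takes on the cycle away from `x`; the remaining cycles lie in `Below t` and avoid `x`.
  Codes : Subset (2 + k) → Subset n → Set
  Codes (inside  Vec.∷ T) S = x ∈ S × IsInducedCycle G S × (∀ {v} → v ∈ S → Q v) ×
                              (∀ {i} → i ∈ T → ColourOf S i) × (∀ {i} → ColourOf S i → i ∈ T)
  Codes (outside Vec.∷ T) S = Codes₀ T S
  total : ∀ {T} → IsTriple T → ∃[ S ] Codes T S
  total {outside Vec.∷ T} three = total₀ (tail-triple three)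
  total {inside  Vec.∷ T} three with tail-pair three
  ... | i , j , i≢j , i∈ , j∈ , onto
    with kempeCycle G (Below? t) x∉ proper ¬extended i≢j
  ... | S , isCyc , x∈ , inner , hasI , hasJ = S , x∈ , isCyc , inQ ,
      (λ a∈ → case onto a∈ of λ { (inj₁ refl) → hasI ; (inj₂ refl) → hasJ }) ,
      λ { (v , v∈ , v≢x , refl) → case proj₂ (inner v∈ v≢x) of λ where
            (inj₁ eq) → subst (_∈ T) (sym eq) i∈
            (inj₂ eq) → subst (_∈ T) (sym eq) j∈ }
    where
    inQ : ∀ {v} → v ∈ S → Q v
    inQ {v} v∈ with v Fin.≟ x
    ... | yes refl = Qx
    ... | no v≢x   = proj₁ (proj₁ (inner v∈ v≢x))
  valid : ∀ {T S} → Codes T S → IsInducedCycle G S × (∀ {v} → v ∈ S → Q v)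
  valid {inside  Vec.∷ T} (_ , isCyc , inQ , _) = isCyc , inQ
  valid {outside Vec.∷ T} code = let isCyc , below = valid₀ code in isCyc , proj₁ ∘ below
  injective : ∀ {T T′ S} → Codes T S → Codes T′ S → T ≡ T′
  injective {inside Vec.∷ T} {inside Vec.∷ T′} (_ , _ , _ , to , from) (_ , _ , _ , to′ , from′) =
    cong (inside Vec.∷_) (⊆-antisym (from′ ∘ to) (from ∘ to′))
  injective {inside Vec.∷ T} {outside Vec.∷ T′} (x∈ , _) code =
    contradiction (proj₂ (valid₀ code) x∈) x∉
  injective {outside Vec.∷ T} {inside Vec.∷ T′} code (x∈ , _) =
    contradiction (proj₂ (valid₀ code) x∈) x∉
  injective {outside Vec.∷ T} {outside Vec.∷ T′} code code′ =
    cong (outside Vec.∷_) (injective₀ code code′)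

-- Rotating a cycle to a chosen starting point.

-- Each rotation raises the index of the marked vertex by one, and `t` counts the rotations still to
-- be made.
rotateToEnd : ∀ {G : Graph (Fin n)} {S k} {X : Pred (Fin n) 0ℓ} t {j p} → CycleIn G S k p →
              j + t ≡ 2 + k → X (p j) → ∃[ p′ ] CycleIn G S k p′ × X (p′ (2 + k))
rotateToEnd {X = X} zero {j} {p} cyc eq Xj =
  _ , cyc , subst (X ∘ p) (trans (sym (ℕ.+-identityʳ j)) eq) Xj
rotateToEnd {X = X} (suc t) {j} cyc eq Xj =
  rotateToEnd {X = X} t {suc j} (rotateIn cyc) (trans (sym (ℕ.+-suc j t)) eq) Xj

rotateToLast : ∀ {G : Graph (Fin n)} {S k p} {X : Pred (Fin n) 0ℓ} → CycleIn G S k p →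
               ∀ {x} → x ∈ S → X x → ∃[ p′ ] CycleIn G S k p′ × X (p′ (2 + k))
rotateToLast {X = X} cyc x∈ Xx with CycleIn.onto cyc x∈
... | j , j<l , refl = let t , eq = ℕ.m≤n⇒∃[o]m+o≡n (s≤s⁻¹ j<l) in rotateToEnd {X = X} t cyc eq Xx

-- With a vertex of `X` in last place, rotate until its predecessor is outside `X`. This happens
-- before `y` reaches the last place, which always carries a vertex of `X` during the search.
rotateToBoundary : ∀ {G : Graph (Fin n)} {S k p} {X : Pred (Fin n) 0ℓ} → Decidable X → CycleIn G S k p →
                   ∀ {x y} → x ∈ S → X x → y ∈ S → ¬ X y →
                   ∃[ p′ ] CycleIn G S k p′ × X (p′ 0) × ¬ X (p′ (2 + k))
rotateToBoundary {n = n} {G = G} {S} {k} {X = X} X? cyc x∈ Xx y∈ ¬Xy with rotateToLast {X = X} cyc x∈ Xx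
... | p , cyc′ , Xlast with CycleIn.onto cyc′ y∈
... | j , j<l , refl = let t , eq = ℕ.m≤n⇒∃[o]m+o≡n (s≤s⁻¹ j<l) in search t cyc′ Xlast eq ¬Xy
  where
  search : ∀ t {j p} → CycleIn G S k p → X (p (2 + k)) → j + t ≡ 2 + k → ¬ X (p j) →
           ∃[ p′ ] CycleIn G S k p′ × X (p′ 0) × ¬ X (p′ (2 + k))
  search zero    {j} {p} cyc Xl eq ¬Xj =
    contradiction (subst (X ∘ p) (trans (sym eq) (ℕ.+-identityʳ j)) Xl) ¬Xj
  search (suc t) {j} {p} cyc Xl eq ¬Xj with X? (p (1 + k))
  ... | yes X1 = search t {suc j} (rotateIn cyc) X1 (trans (sym (ℕ.+-suc j t)) eq) ¬Xj
  ... | no ¬X1 = _ , rotateIn cyc , Xl , ¬X1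

sequence⇒triple : ∀ {G : Graph (Fin n)} {S d} → CycleIn G S 0 d → Triple S (d 0) (d 1) (d 2)
sequence⇒triple {S = S} {d} cyc = triple (distinct z<s (s<s z<s)) (distinct z<s (s<s (s<s z<s)))
  (distinct (s<s z<s) (s<s (s<s z<s))) (into z<s) (into (s<s z<s)) (into (s<s (s<s z<s))) onto′
  where
  open CycleIn cyc
  onto′ : ∀ {x} → x ∈ S → x ≡ d 0 ⊎ x ≡ d 1 ⊎ x ≡ d 2
  onto′ x∈ with onto x∈
  ... | 0 , _ , refl = inj₁ refl
  ... | 1 , _ , refl = inj₂ (inj₁ refl)
  ... | 2 , _ , refl = inj₂ (inj₂ refl)
  ... | suc (suc (suc _)) , s≤s (s≤s (s≤s ())) , _

trivialCoding : {G : Graph (Fin n)} {Q : Pred (Fin n) 0ℓ} → TripleCoding G Q 0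
trivialCoding = record
  { Codes = λ _ _ → ⊥ ; total = λ () ; valid = λ () ; injective = λ () }

-- Classes of the compression and lifts of induced cycles.

module Compression (G : Graph (Fin n)) (w : Fin n) (H : Graph (Fin m))
                   (compression : IsVertexCompression G w H) where

  open IsVertexCompression compression renaming (quotient to q)
  open IsQuotient (contractions⇒quotient contractions) using (surjective; hom; lift)

  N : Pred (Fin n) 0ℓ
  N = Adj G w

  N? : Decidable N
  N? = adj? G w

  ŵ : Fin m
  ŵ = q w

  -- The image of the open neighbourhood. The complete graph created by the compression consists of
  -- `K` and `ŵ`.
  K : Pred (Fin m) 0ℓ
  K a = ∃[ x ] N x × q x ≡ a

  K? : Decidable K
  K? a = Fin.any? λ x → N? x ×-dec (q x Fin.≟ a)

  -- An edge inside a class would map to a loop of `H`.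
  independent : ∀ {x y} → q x ≡ q y → ¬ Adj G x y
  independent {x} eq a = irrefl H (subst (Adj H (q x)) (sym eq) (hom a))

  ¬Nw : ¬ N w
  ¬Nw = irrefl G

  -- Identified vertices lie in the closed neighbourhood, and `w` cannot share a class with one of
  -- its own neighbours.
  N-class : ∀ {x y} → N x → q x ≡ q y → N y
  N-class Nx eq with contractions-kernel contractions eq
  ... | inj₁ refl            = Nx
  ... | inj₂ (_ , inj₁ refl) = contradiction Nx (independent (sym eq))
  ... | inj₂ (_ , inj₂ Ny)   = Ny

  singleton : ∀ {x y} → ¬ N x → q x ≡ q y → x ≡ y
  singleton ¬Nx eq with contractions-kernel contractions eq
  ... | inj₁ x≡y                      = x≡y
  ... | inj₂ (inj₂ Nx , _)            = contradiction Nx ¬Nx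
  ... | inj₂ (inj₁ refl , inj₁ refl)  = refl
  ... | inj₂ (inj₁ refl , inj₂ Ny)    = contradiction Ny (independent eq)

  K⇒N : ∀ {x} → K (q x) → N x
  K⇒N (_ , Ny , eq) = N-class Ny eq

  clique-index : ∀ {x} → ClosedNbhd G w x → ∃[ i ] lookup (proj₁ becomesK) i ≡ q x
  clique-index x∈ = IsIsoOnto.onto (proj₂ becomesK) (_ , x∈ , refl)

  clique : ∀ {a b} → K a → K b → a ≢ b → Adj H a b
  clique (x , Nx , refl) (y , Ny , refl) a≢b
    with clique-index (inj₂ Nx) | clique-index (inj₂ Ny)
  ... | i , eq | j , eq′ = subst₂ (Adj H) eq eq′ (IsIsoOnto.preserves (proj₂ becomesK) i j
    λ { refl → a≢b (trans (sym eq) eq′) })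

  -- Off `K` the fibres are single vertices and `sect` inverts `q`; on `K` it makes an arbitrary
  -- choice.
  sect : Fin m → Fin n
  sect a = proj₁ (surjective a)

  q-sect : ∀ a → q (sect a) ≡ a
  q-sect a = proj₂ (surjective a)

  ¬N-sect : ∀ {a} → ¬ K a → ¬ N (sect a)
  ¬N-sect {a} ¬Ka Ns = ¬Ka (_ , Ns , q-sect a)

  -- The class of `y` is `y` alone, so a lifted edge has to end in `y` itself; only its other end is
  -- a matter of choice.
  liftAt : ∀ {a y} → ¬ N y → Adj H a (q y) → ∃[ x ] q x ≡ a × Adj G x y
  liftAt ¬Ny a with lift a
  ... | x , y′ , eq , eq′ , b with singleton ¬Ny (sym eq′)
  ... | refl = x , eq , b

  liftSect : ∀ {a b} → ¬ K b → Adj H a b → ∃[ x ] q x ≡ a × Adj G x (sect b)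
  liftSect {a} {b} ¬Kb adj = liftAt (¬N-sect ¬Kb) (subst (Adj H a) (sym (q-sect b)) adj)

  sect-adj : ∀ {a b} → ¬ K a → ¬ K b → Adj H a b → Adj G (sect a) (sect b)
  sect-adj {a} ¬Ka ¬Kb adj with liftSect ¬Kb adj
  ... | x , eq , b with singleton (¬N-sect ¬Ka) (trans (q-sect a) (sym eq))
  ... | refl = b

  hom-sect : ∀ {a b} → Adj G (sect a) (sect b) → Adj H a b
  hom-sect {a} {b} adj = subst₂ (Adj H) (q-sect a) (q-sect b) (hom adj)

  hom-to : ∀ {x a b} → q x ≡ a → Adj G x (sect b) → Adj H a b
  hom-to {b = b} eq adj = subst₂ (Adj H) eq (q-sect b) (hom adj)

  sect-injective : ∀ {a b} → sect a ≡ sect b → a ≡ b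
  sect-injective {a} {b} eq = trans (sym (q-sect a)) (trans (cong q eq) (q-sect b))

  ŵ-neighbour : ∀ {a} → Adj H ŵ a → K a
  ŵ-neighbour adj with lift adj
  ... | x , y , eq , eq′ , a with singleton ¬Nw (sym eq)
  ... | refl = y , a , eq′

  liftPath : ∀ {d} → PathOn H l d → (∀ {i} → i < l → ¬ K (d i)) → PathOn G l (sect ∘ d)
  liftPath path ¬K = record
    { distinct    = λ i<j j<l → distinct i<j j<l ∘ sect-injective
    ; consecutive = λ i<l → sect-adj (¬K (ℕ.<-trans (ℕ.n<1+n _) i<l)) (¬K i<l) (consecutive i<l)
    ; chordless   = λ i<j j<l → chordless i<j j<l ∘ hom-sect
    }
    where
    open PathOn path

  liftOutsideCycle : ∀ {d} → CycleOn H k d → (∀ {i} → i < 3 + k → ¬ K (d i)) → CycleOn G k (sect ∘ d)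
  liftOutsideCycle cyc ¬K = record
    { distinct    = λ i<j j<l → distinct i<j j<l ∘ sect-injective
    ; consecutive = λ i<l → sect-adj (¬K (ℕ.<-trans (ℕ.n<1+n _) i<l)) (¬K i<l) (consecutive i<l)
    ; closing     = sect-adj (¬K ℕ.≤-refl) (¬K z<s) closing
    ; chordless   = λ i<j j<l → chordless i<j j<l ∘ hom-sect
    }
    where
    open CycleOn cyc

  -- The detour: `w` is adjacent to `u` and `v` and to nothing on `P`, so it joins two nonadjacent
  -- ends without creating a chord. For `l = 0` the result is a 4-cycle.
  closeThroughW : ∀ {l P u v} → PathOn G (suc l) P → (∀ {i} → i < suc l → ¬ N (P i)) →
                  (∀ {i} → i < suc l → P i ≢ w) → N u → N v → u ≢ v → ¬ Adj G v u →
                  Adj G u (P 0) → (∀ {i} → i < suc l → Adj G u (P i) → i ≡ 0) →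
                  Adj G v (P l) → (∀ {i} → i < suc l → Adj G v (P i) → i ≡ l) →
                  CycleOn G (suc l) (v ◃ w ◃ u ◃ P)
  closeThroughW {l} {P} {u} {v} path ¬NP P≢w Nu Nv u≢v ¬vu u-first u-only v-last v-only =
    close (extend (extend path (N≢P Nu) u-first u-only) w∉ Nu w-only) v∉ (symm G Nv) v-last only
    where
    N≢P : ∀ {x i} → N x → i < suc l → x ≢ P i
    N≢P Nx i<l refl = ¬NP i<l Nx
    w∉ : ∀ {i} → i < 2 + l → w ≢ (u ◃ P) i
    w∉ {zero}  _   refl = ¬Nw Nu
    w∉ {suc i} i<l eq   = P≢w (s<s⁻¹ i<l) (sym eq)
    w-only : ∀ {i} → i < 2 + l → N ((u ◃ P) i) → i ≡ 0
    w-only {zero}  _   _  = refl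
    w-only {suc i} i<l Np = contradiction Np (¬NP (s<s⁻¹ i<l))
    v∉ : ∀ {i} → i < 3 + l → v ≢ (w ◃ u ◃ P) i
    v∉ {zero}        _   refl = ¬Nw Nv
    v∉ {suc zero}    _   eq   = u≢v (sym eq)
    v∉ {suc (suc i)} i<l      = N≢P Nv (s<s⁻¹ (s<s⁻¹ i<l))
    only : ∀ {i} → i < 3 + l → Adj G v ((w ◃ u ◃ P) i) → i ≡ 0 ⊎ i ≡ 2 + l
    only {zero}        _   _ = inj₁ refl
    only {suc zero}    _   a = contradiction a ¬vu
    only {suc (suc i)} i<l a = inj₂ (cong (2 +_) (v-only (s<s⁻¹ (s<s⁻¹ i<l)) a))

  -- Apart from `w`, `S` maps onto `D`. Hence `S` determines `D`, whether or not the lift made a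
  -- detour through `w`.
  record Covers (D : Subset m) (S : Subset n) : Set where
    field
      image : ∀ {x} → x ∈ S → x ≢ w → q x ∈ D
      cover : ∀ {a} → a ∈ D → ∃[ x ] x ∈ S × x ≢ w × q x ≡ a

  module _ {D : Subset m} (ŵ∉D : ŵ ∉ D) where

    LiftedCycle : Set
    LiftedCycle = ∃[ S ] IsInducedCycle G S × Covers D S

    module _ {k d} (cycIn : CycleIn H D k d) where

      open CycleIn cycIn

      sect≢w : ∀ {i} → i < 3 + k → sect (d i) ≢ w
      sect≢w {i} i<l eq = ŵ∉D (subst (_∈ D) (trans (sym (q-sect (d i))) (cong q eq)) (into i<l))

      sect∈ : ∀ {i} → i < 3 + k → q (sect (d i)) ∈ D
      sect∈ {i} i<l = subst (_∈ D) (sym (q-sect (d i))) (into i<l)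

      q∈ : ∀ {x i} → i < 3 + k → q x ≡ d i → q x ∈ D
      q∈ i<l eq = subst (_∈ D) (sym eq) (into i<l)

      liftedCycle : ∀ {k′ e} → CycleOn G k′ e →
        (∀ {i} → i < 3 + k′ → e i ≢ w → q (e i) ∈ D) →
        (∀ {j} → j < 3 + k → ∃[ i ] i < 3 + k′ × q (e i) ≡ d j) → LiftedCycle
      liftedCycle {k′} {e} cyc image cover with cycle⇒inducedCycle cyc
      ... | S , isCyc , inS = S , isCyc , record { image = image′ ; cover = cover′ }
        where
        module S = CycleIn inS
        image′ : ∀ {x} → x ∈ S → x ≢ w → q x ∈ D
        image′ x∈ x≢w with S.onto x∈
        ... | i , i<l , refl = image i<l x≢w
        cover′ : ∀ {a} → a ∈ D → ∃[ x ] x ∈ S × x ≢ w × q x ≡ a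
        cover′ a∈ with onto a∈
        ... | j , j<l , refl with cover j<l
        ... | i , i<l , eq = e i , S.into i<l ,
          (λ e≡w → ŵ∉D (subst (_∈ D) (trans (sym eq) (cong q e≡w)) a∈)) , eq

      liftOutside : (∀ {i} → i < 3 + k → ¬ K (d i)) → LiftedCycle
      liftOutside ¬K = liftedCycle (liftOutsideCycle isCycle ¬K) (λ i<l _ → sect∈ i<l)
        λ {j} j<l → j , j<l , q-sect (d j)

      -- Any other cycle vertex in `K` would be adjacent to `d 0`, hence be one of its two cycle
      -- neighbours, which lie outside `K`. The two edges at `d 0` lift to edges at preimages `u`
      -- and `v`. If one of these sees both ends of the lifted path, it closes the cycle; if not,
      -- they are distinct and nonadjacent, being in one class, and are joined through `w`.
      liftOne : K (d 0) → ¬ K (d 1) → ¬ K (d (2 + k)) → LiftedCycle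
      liftOne K0 ¬K1 ¬Kl = result
        where
        ¬Ks : ∀ {i} → i < 2 + k → ¬ K (d (suc i))
        ¬Ks i<l Kd with chordless z<s (s<s i<l) (clique K0 Kd (distinct z<s (s<s i<l)))
        ... | inj₁ refl       = ¬K1 Kd
        ... | inj₂ (_ , refl) = ¬Kl Kd
        P : ℕ → Fin n
        P = sect ∘ d ∘ suc
        path : PathOn G (2 + k) P
        path = liftPath (tailCycle isCycle) ¬Ks
        ends : ∀ {x i} → q x ≡ d 0 → i < 2 + k → Adj G x (P i) → i ≡ 0 ⊎ i ≡ 1 + k
        ends eq i<l a = Sum.map (sym ∘ ℕ.suc-injective) (ℕ.suc-injective ∘ proj₂)
          (chordless z<s (s<s i<l) (hom-to eq a))
        N0 : ∀ {x} → q x ≡ d 0 → N x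
        N0 eq = K⇒N (subst K (sym eq) K0)
        closed : ∀ {x} → q x ≡ d 0 → Adj G x (P 0) → Adj G x (P (1 + k)) → LiftedCycle
        closed {x} eq first last = liftedCycle
          (close path (λ { i<l refl → ¬N-sect (¬Ks i<l) (N0 eq) }) first last (ends eq))
          (λ { {zero} _ _ → q∈ z<s eq ; {suc i} i<l _ → sect∈ i<l })
          λ { {zero} _ → 0 , z<s , eq ; {suc j} j<l → suc j , j<l , q-sect _ }
        result : LiftedCycle
        result with liftSect ¬K1 (consecutive (s<s z<s)) | liftSect ¬Kl (symm H closing)
        ... | u , qu , u0 | v , qv , vl with adj? G v (P 0) | adj? G u (P (1 + k))
        ... | yes v0 | _      = closed qv v0 vl
        ... | no _   | yes ul = closed qu u0 ul
        ... | no ¬v0 | no ¬ul = liftedCycle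
          (closeThroughW path (¬N-sect ∘ ¬Ks) (sect≢w ∘ s<s) (N0 qu) (N0 qv)
            (λ { refl → ¬v0 u0 }) (independent (trans qv (sym qu))) u0
            (λ i<l a → case ends qu i<l a of λ { (inj₁ eq) → eq ; (inj₂ refl) → contradiction a ¬ul })
            vl
            (λ i<l a → case ends qv i<l a of λ { (inj₁ refl) → contradiction a ¬v0 ; (inj₂ eq) → eq }))
          (λ { {zero} _ _ → q∈ z<s qv
             ; {suc zero} _ w≢w → contradiction refl w≢w
             ; {suc (suc zero)} _ _ → q∈ z<s qu
             ; {suc (suc (suc i))} i<l _ → sect∈ (s<s⁻¹ (s<s⁻¹ i<l)) })
          λ { {zero} _ → 0 , z<s , qv ; {suc j} j<l → 3 + j , s<s (s<s j<l) , q-sect _ }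

      -- A further vertex of the cycle in `K` would be adjacent to `d 0`, hence be the last one,
      -- which lies outside `K`. The rest lifts to a path with a preimage `u` of `d 1` at its start
      -- and a preimage `v` of `d 0` at its end, joined by an edge if there is one and through `w`
      -- otherwise.
      liftTwo : K (d 0) → K (d 1) → ¬ K (d (2 + k)) → LiftedCycle
      liftTwo K0 K1 ¬Kl = result
        where
        last-only : ∀ {i} → i < 1 + k → Adj H (d 0) (d (2 + i)) → i ≡ k
        last-only i<l a with chordless z<s (s<s (s<s i<l)) a
        ... | inj₂ (_ , eq) = ℕ.suc-injective (ℕ.suc-injective eq)
        ¬Ks : ∀ {i} → i < 1 + k → ¬ K (d (2 + i))
        ¬Ks i<l Kd with last-only i<l (clique K0 Kd (distinct z<s (s<s (s<s i<l))))
        ... | refl = ¬Kl Kd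
        P : ℕ → Fin n
        P i = sect (d (2 + i))
        path : PathOn G (1 + k) P
        path = liftPath (tailPath (tailCycle isCycle)) ¬Ks
        result : LiftedCycle
        result with liftSect (¬Ks z<s) (consecutive {1} (s<s (s<s z<s))) | liftSect ¬Kl (symm H closing)
        ... | u , qu , u0 | v , qv , vl = join (adj? G v u)
          where
          Nu : N u
          Nu = K⇒N (subst K (sym qu) K1)
          Nv : N v
          Nv = K⇒N (subst K (sym qv) K0)
          u≢v : u ≢ v
          u≢v refl = distinct {0} {1} z<s (s<s z<s) (trans (sym qv) qu)
          u-only : ∀ {i} → i < 1 + k → Adj G u (P i) → i ≡ 0
          u-only i<l a with chordless {1} (s<s z<s) (s<s (s<s i<l)) (hom-to qu a)
          ... | inj₁ refl = refl
          v-only : ∀ {i} → i < 1 + k → Adj G v (P i) → i ≡ k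
          v-only i<l a = last-only i<l (hom-to qv a)
          N≢P : ∀ {x i} → N x → i < 1 + k → x ≢ P i
          N≢P Nx i<l refl = ¬N-sect (¬Ks i<l) Nx
          v∉ : ∀ {i} → i < 2 + k → v ≢ (u ◃ P) i
          v∉ {zero}  _   = u≢v ∘ sym
          v∉ {suc i} i<l = N≢P Nv (s<s⁻¹ i<l)
          only : ∀ {i} → i < 2 + k → Adj G v ((u ◃ P) i) → i ≡ 0 ⊎ i ≡ 1 + k
          only {zero}  _   _ = inj₁ refl
          only {suc i} i<l a = inj₂ (cong suc (v-only (s<s⁻¹ i<l) a))
          join : Dec (Adj G v u) → LiftedCycle
          join (yes vu) = liftedCycle (close (extend path (N≢P Nu) u0 u-only) v∉ vu vl only)
            (λ { {zero} _ _ → q∈ z<s qv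
               ; {suc zero} _ _ → q∈ (s<s z<s) qu
               ; {suc (suc i)} i<l _ → sect∈ i<l })
            λ { {zero} _ → 0 , z<s , qv
              ; {suc zero} _ → 1 , s<s z<s , qu
              ; {suc (suc j)} j<l → 2 + j , j<l , q-sect _ }
          join (no ¬vu) = liftedCycle
            (closeThroughW path (¬N-sect ∘ ¬Ks) (sect≢w ∘ s<s ∘ s<s) Nu Nv u≢v ¬vu u0 u-only vl v-only)
            (λ { {zero} _ _ → q∈ z<s qv
               ; {suc zero} _ w≢w → contradiction refl w≢w
               ; {suc (suc zero)} _ _ → q∈ (s<s z<s) qu
               ; {suc (suc (suc i))} i<l _ → sect∈ (s<s⁻¹ i<l) })
            λ { {zero} _ → 0 , z<s , qv
              ; {suc zero} _ → 2 , s<s (s<s z<s) , qu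
              ; {suc (suc j)} j<l → 3 + j , s<s j<l , q-sect _ }

    liftCycle : IsInducedCycle H D → (∃[ a ] a ∈ D × ¬ K a) → LiftedCycle
    liftCycle isCyc (a , a∈ , ¬Ka) with inducedCycle⇒sequence isCyc
    ... | k , d , cycIn with Fin.any? (λ b → (b ∈? D) ×-dec K? b)
    ... | no none = liftOutside cycIn λ i<l Kd → none (_ , CycleIn.into cycIn i<l , Kd)
    ... | yes (b , b∈ , Kb) with rotateToBoundary {X = K} K? cycIn b∈ Kb a∈ ¬Ka
    ... | d′ , cycIn′ , K0 , ¬Kl with K? (d′ 1)
    ... | yes K1 = liftTwo cycIn′ K0 K1 ¬Kl
    ... | no ¬K1 = liftOne cycIn′ K0 ¬K1 ¬Kl

  -- The vertices at indices 0 and 2 are adjacent in the clique, and chordlessness allows this only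
  -- in a triangle.
  cliqueTriangle : ∀ {D} → IsInducedCycle H D → (∀ {a} → a ∈ D → K a) → IsTriple D
  cliqueTriangle isCyc inK with inducedCycle⇒sequence isCyc
  ... | k , d , cycIn
    with CycleIn.chordless cycIn {0} {2} z<s (s<s (s<s z<s))
           (clique (inK (CycleIn.into cycIn z<s)) (inK (CycleIn.into cycIn (s<s (s<s z<s))))
             (CycleIn.distinct cycIn z<s (s<s (s<s z<s))))
  ... | inj₂ (_ , refl) = _ , _ , _ , sequence⇒triple cycIn

  -- Both cycle neighbours of `ŵ` lie in `K` and are therefore adjacent, which forces length three.
  wTriangle : ∀ {D} → IsInducedCycle H D → ŵ ∈ D → ∃[ a ] ∃[ b ] K a × K b × Triple D a b ŵ
  wTriangle isCyc ŵ∈ with inducedCycle⇒sequence isCyc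
  ... | k , d , cycIn with rotateToLast {X = _≡ ŵ} cycIn ŵ∈ refl
  ... | d′ , cycIn′ , last = fromNeighbours cycIn′ last
      (ŵ-neighbour (subst (λ b → Adj H b _) last closing))
      (ŵ-neighbour (subst (λ b → Adj H b _) last (symm H (consecutive ℕ.≤-refl))))
    where
    open CycleIn cycIn′
    fromNeighbours : ∀ {k D d} → CycleIn H D k d → d (2 + k) ≡ ŵ → K (d 0) → K (d (1 + k)) →
                     ∃[ a ] ∃[ b ] K a × K b × Triple D a b ŵ
    fromNeighbours {zero}  cyc last K0 K1 =
      _ , _ , K0 , K1 , subst (Triple _ _ _) last (sequence⇒triple cyc)
    fromNeighbours {suc k} cyc _ K0 K1 = case
      CycleIn.chordless cyc z<s (ℕ.n≤1+n _) (clique K0 K1 (CycleIn.distinct cyc z<s (ℕ.n≤1+n _))) of λ where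
        (inj₁ ())
        (inj₂ (_ , ()))

-- Comparing lengths of lists, and the combined list of cycles, edges and vertices.

lookup-injective : ∀ {A : Set} {xs : List A} → Unique xs →
                   ∀ i j → List.lookup xs i ≡ List.lookup xs j → i ≡ j
lookup-injective (x∉ AllPairs.∷ u) zero    zero    eq = refl
lookup-injective (x∉ AllPairs.∷ u) zero    (suc j) eq = contradiction eq (All.lookup x∉ (∈ᴸ.∈-lookup j))
lookup-injective (x∉ AllPairs.∷ u) (suc i) zero    eq = contradiction (sym eq) (All.lookup x∉ (∈ᴸ.∈-lookup i))
lookup-injective (x∉ AllPairs.∷ u) (suc i) (suc j) eq = cong suc (lookup-injective u i j eq)

length-≤-via : ∀ {A B : Set} {xs : List A} {ys : List B} (R : A → B → Set) → Unique xs →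
               (∀ {x} → x ∈ᴸ.∈ xs → ∃[ y ] y ∈ᴸ.∈ ys × R x y) →
               (∀ {x x′ y} → R x y → R x′ y → x ≡ x′) → length xs ≤ length ys
length-≤-via {xs = xs} {ys} R unique total injective = Fin.injective⇒≤ {f = f} λ {i} {j} eq →
  lookup-injective unique i j (injective (R-f i) (subst (λ t → R _ (List.lookup ys t)) (sym eq) (R-f j)))
  where
  f : Fin (length xs) → Fin (length ys)
  f i = Any.index (proj₁ (proj₂ (total (∈ᴸ.∈-lookup i))))
  R-f : ∀ i → R (List.lookup xs i) (List.lookup ys (f i))
  R-f i = let y , y∈ , r = total (∈ᴸ.∈-lookup {xs = xs} i) in subst (R _) (Any.lookup-index y∈) r

subsets-complete : ∀ {n} (S : Subset n) → S ∈ᴸ.∈ subsets n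
subsets-complete Vec.[]               = Any.here refl
subsets-complete (inside  Vec.∷ S)    = ∈ᴸ.∈-++⁺ˡ (∈ᴸ.∈-map⁺ _ (subsets-complete S))
subsets-complete {suc n} (outside Vec.∷ S) =
  ∈ᴸ.∈-++⁺ʳ (List.map (inside Vec.∷_) (subsets n)) (∈ᴸ.∈-map⁺ _ (subsets-complete S))

subsets-unique : ∀ n → Unique (subsets n)
subsets-unique zero    = All.[] AllPairs.∷ AllPairs.[]
subsets-unique (suc n) = Unique.++⁺ (Unique.map⁺ Vec.∷-injectiveʳ (subsets-unique n))
  (Unique.map⁺ Vec.∷-injectiveʳ (subsets-unique n)) disjoint
  where
  disjoint : ∀ {v} → ¬ (v ∈ᴸ.∈ List.map (inside Vec.∷_) (subsets n) × v ∈ᴸ.∈ List.map (outside Vec.∷_) (subsets n))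
  disjoint (p , q) with ∈ᴸ.∈-map⁻ _ p | ∈ᴸ.∈-map⁻ _ q
  ... | _ , _ , refl | _ , _ , ()

-- The edge counts change sides so that no subtraction occurs: cycles and vertices come from a graph
-- on `k` vertices, edges from the other graph, on `l` vertices.
Item : ℕ → ℕ → Set
Item k l = Subset k ⊎ (Fin l × Fin l) ⊎ Fin k

pattern cyc S  = inj₁ S
pattern edge e = inj₂ (inj₁ e)
pattern vert v = inj₂ (inj₂ v)

IsEdge : Graph (Fin n) → Fin n × Fin n → Set
IsEdge G (i , j) = i Fin.< j × Adj G i j

IsItem : Graph (Fin k) → Graph (Fin l) → Item k l → Set
IsItem F E (cyc S)  = IsInducedCycle F S
IsItem F E (edge e) = IsEdge E e
IsItem F E (vert v) = ⊤

disjointUnion : {A B C : Set} → List A → List B → List C → List (A ⊎ B ⊎ C)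
disjointUnion xs ys zs = List.map inj₁ xs List.++ List.map (inj₂ ∘ inj₁) ys List.++ List.map (inj₂ ∘ inj₂) zs

module _ {A B C : Set} {xs : List A} {ys : List B} {zs : List C} where

  length-disjointUnion : length (disjointUnion xs ys zs) ≡ length xs + (length ys + length zs)
  length-disjointUnion = trans (List.length-++ (List.map inj₁ xs)) (cong₂ _+_ (List.length-map inj₁ xs)
    (trans (List.length-++ (List.map (inj₂ ∘ inj₁) ys)) (cong₂ _+_
      (List.length-map (inj₂ ∘ inj₁) ys) (List.length-map (inj₂ ∘ inj₂) zs))))

  disjointUnion-unique : Unique xs → Unique ys → Unique zs → Unique (disjointUnion xs ys zs)
  disjointUnion-unique u v w = Unique.++⁺ (Unique.map⁺ Sum.inj₁-injective u)
    (Unique.++⁺ (Unique.map⁺ (λ { refl → refl }) v) (Unique.map⁺ (λ { refl → refl }) w) second≢third)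
    first≢rest
    where
    second≢third : ∀ {x} → ¬ (x ∈ᴸ.∈ List.map (inj₂ ∘ inj₁) ys × x ∈ᴸ.∈ List.map (inj₂ ∘ inj₂) zs)
    second≢third (p , q) with ∈ᴸ.∈-map⁻ _ p | ∈ᴸ.∈-map⁻ _ q
    ... | _ , _ , refl | _ , _ , ()
    first≢rest : ∀ {x} → ¬ (x ∈ᴸ.∈ List.map inj₁ xs ×
                            x ∈ᴸ.∈ List.map (inj₂ ∘ inj₁) ys List.++ List.map (inj₂ ∘ inj₂) zs)
    first≢rest (p , q) with ∈ᴸ.∈-map⁻ _ p | ∈ᴸ.∈-++⁻ (List.map (inj₂ ∘ inj₁) ys) q
    ... | _ , _ , refl | inj₁ r = case ∈ᴸ.∈-map⁻ _ r of λ { (_ , _ , ()) }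
    ... | _ , _ , refl | inj₂ r = case ∈ᴸ.∈-map⁻ _ r of λ { (_ , _ , ()) }

  ∈-disjointUnion⁺ : ∀ {x} → [ ∈ᴸ._∈ xs , [ ∈ᴸ._∈ ys , ∈ᴸ._∈ zs ]′ ]′ x → x ∈ᴸ.∈ disjointUnion xs ys zs
  ∈-disjointUnion⁺ {inj₁ x}        x∈ = ∈ᴸ.∈-++⁺ˡ (∈ᴸ.∈-map⁺ _ x∈)
  ∈-disjointUnion⁺ {inj₂ (inj₁ y)} y∈ = ∈ᴸ.∈-++⁺ʳ (List.map inj₁ xs) (∈ᴸ.∈-++⁺ˡ (∈ᴸ.∈-map⁺ _ y∈))
  ∈-disjointUnion⁺ {inj₂ (inj₂ z)} z∈ =
    ∈ᴸ.∈-++⁺ʳ (List.map inj₁ xs) (∈ᴸ.∈-++⁺ʳ (List.map (inj₂ ∘ inj₁) ys) (∈ᴸ.∈-map⁺ _ z∈))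

  ∈-disjointUnion⁻ : ∀ {x} → x ∈ᴸ.∈ disjointUnion xs ys zs → [ ∈ᴸ._∈ xs , [ ∈ᴸ._∈ ys , ∈ᴸ._∈ zs ]′ ]′ x
  ∈-disjointUnion⁻ x∈ with ∈ᴸ.∈-++⁻ (List.map inj₁ xs) x∈
  ... | inj₁ p with ∈ᴸ.∈-map⁻ _ p
  ...   | _ , y∈ , refl = y∈
  ∈-disjointUnion⁻ x∈ | inj₂ p with ∈ᴸ.∈-++⁻ (List.map (inj₂ ∘ inj₁) ys) p
  ... | inj₁ q with ∈ᴸ.∈-map⁻ _ q
  ...   | _ , y∈ , refl = y∈
  ∈-disjointUnion⁻ x∈ | inj₂ p | inj₂ q with ∈ᴸ.∈-map⁻ _ q
  ... | _ , y∈ , refl = y∈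

module _ (F : Graph (Fin k)) (E : Graph (Fin l)) where

  edge? : Decidable (IsEdge E)
  edge? e = (proj₁ e Fin.<? proj₂ e) ×-dec adj? E (proj₁ e) (proj₂ e)

  items : List (Item k l)
  items = disjointUnion (inducedCycles F) (edges E) (allFin k)

  length-items : length items ≡ length (inducedCycles F) + (length (edges E) + k)
  length-items = trans (length-disjointUnion {xs = inducedCycles F} {ys = edges E})
    (cong (λ t → length (inducedCycles F) + (length (edges E) + t)) (List.length-tabulate {n = k} id))

  items-unique : Unique items
  items-unique = disjointUnion-unique
    (Unique.filter⁺ (isInducedCycle? F) (subsets-unique k))
    (Unique.filter⁺ edge? (Unique.cartesianProduct⁺ (Unique.allFin⁺ l) (Unique.allFin⁺ l)))
    (Unique.allFin⁺ k)

  ∈-items⁺ : ∀ {x} → IsItem F E x → x ∈ᴸ.∈ items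
  ∈-items⁺ {cyc S}  c = ∈-disjointUnion⁺ {xs = inducedCycles F} {edges E} {allFin k} {cyc S}
    (∈ᴸ.∈-filter⁺ (isInducedCycle? F) (subsets-complete S) c)
  ∈-items⁺ {edge e} p = ∈-disjointUnion⁺ {xs = inducedCycles F} {edges E} {allFin k} {edge e}
    (∈ᴸ.∈-filter⁺ edge? (∈ᴸ.∈-cartesianProduct⁺ (∈ᴸ.∈-allFin (proj₁ e)) (∈ᴸ.∈-allFin (proj₂ e))) p)
  ∈-items⁺ {vert v} _ = ∈-disjointUnion⁺ {xs = inducedCycles F} {edges E} {allFin k} {vert v} (∈ᴸ.∈-allFin v)

  ∈-items⁻ : ∀ {x} → x ∈ᴸ.∈ items → IsItem F E x
  ∈-items⁻ {cyc S}  x∈ = proj₂ (∈ᴸ.∈-filter⁻ (isInducedCycle? F) {xs = subsets k}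
    (∈-disjointUnion⁻ {xs = inducedCycles F} {edges E} {allFin k} x∈))
  ∈-items⁻ {edge e} x∈ = proj₂ (∈ᴸ.∈-filter⁻ edge? {xs = cartesianProduct (allFin l) (allFin l)}
    (∈-disjointUnion⁻ {xs = inducedCycles F} {edges E} {allFin k} x∈))
  ∈-items⁻ {vert v} x∈ = tt

-- Edges are stored as increasing pairs; `Ends` lets the two endpoints be named in either order.
Ends : Fin n × Fin n → Fin n → Fin n → Set
Ends e a b = proj₁ e Fin.< proj₂ e × (e ≡ (a , b) ⊎ e ≡ (b , a))

module _ {n : ℕ} where

  ends-swap : ∀ {e : Fin n × Fin n} {a b} → Ends e a b → Ends e b a
  ends-swap (lt , eq) = lt , Sum.swap eq

  ends-determine : ∀ {e e′ : Fin n × Fin n} {a b} → Ends e a b → Ends e′ a b → e ≡ e′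
  ends-determine (_ , inj₁ refl) (_ , inj₁ refl) = refl
  ends-determine (p , inj₁ refl) (q , inj₂ refl) = contradiction p (ℕ.<-asym q)
  ends-determine (p , inj₂ refl) (q , inj₁ refl) = contradiction p (ℕ.<-asym q)
  ends-determine (_ , inj₂ refl) (_ , inj₂ refl) = refl

  ends-same : ∀ {e : Fin n × Fin n} {a b c d} → Ends e a b → Ends e c d →
              (a ≡ c × b ≡ d) ⊎ (a ≡ d × b ≡ c)
  ends-same (_ , inj₁ refl) (_ , inj₁ refl) = inj₁ (refl , refl)
  ends-same (_ , inj₁ refl) (_ , inj₂ refl) = inj₂ (refl , refl)
  ends-same (_ , inj₂ refl) (_ , inj₁ refl) = inj₂ (refl , refl)
  ends-same (_ , inj₂ refl) (_ , inj₂ refl) = inj₁ (refl , refl)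

  adj⇒edge : ∀ (G : Graph (Fin n)) {a b} → Adj G a b → ∃[ e ] IsEdge G e × Ends e a b
  adj⇒edge G {a} {b} adj with Fin.<-cmp a b
  ... | tri< a<b _ _  = (a , b) , (a<b , adj) , a<b , inj₁ refl
  ... | tri≈ _ refl _ = ⊥-elim (irrefl G adj)
  ... | tri> _ _ b<a  = (b , a) , (b<a , symm G adj) , b<a , inj₂ refl

-- The injection behind the inequality.

module Counting (G : Graph (Fin n)) (w : Fin n) (H : Graph (Fin m))
                (compression : IsVertexCompression G w H) where

  open IsVertexCompression compression renaming (quotient to q)
  open IsQuotient (contractions⇒quotient contractions) using (hom)
  open Compression G w H compression

  record CliqueCoding : Set₁ where
    field
      {size}   : ℕ
      coding   : TripleCoding G N size
      vertex   : Fin size → Fin m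
      vertex-injective : ∀ {i j} → vertex i ≡ vertex j → i ≡ j
      vertex-onto      : ∀ {a} → K a → ∃[ i ] vertex i ≡ a

  -- A colouring of `N` with `χ - 2` colours and a fresh one for `w` would contradict the minimality
  -- of `χ`. So `N` has a coding for triples from `χ - 1` colours, as many as `K` has vertices.
  cliqueCoding : CliqueCoding
  cliqueCoding = build (lookup (proj₁ becomesK)) (IsIsoOnto.injective (proj₂ becomesK))
    clique-index (proj₂ isChromatic)
    where
    build : ∀ {χ} (e : Fin χ → Fin m) → (∀ {i j} → e i ≡ e j → i ≡ j) →
            (∀ {x} → ClosedNbhd G w x → ∃[ i ] e i ≡ q x) →
            (∀ j → Colourable (induce G (ClosedNbhd G w)) j → χ ≤ j) → CliqueCoding
    build {zero}  e e-inj e-onto minimal = case proj₁ (e-onto (inj₁ refl)) of λ ()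
    build {suc b} e e-inj e-onto minimal = record
      { coding = coding b minimal
      ; vertex = λ i → e (Fin.punchIn i₀ i)
      ; vertex-injective = λ eq → Fin.punchIn-injective i₀ _ _ (e-inj eq)
      ; vertex-onto = onto
      }
      where
      -- The index of `ŵ` in the complete graph; `punchIn` skips it, so the remaining indices
      -- enumerate `K`.
      i₀ = proj₁ (e-onto (inj₁ refl))
      coding : ∀ b → (∀ j → Colourable (induce G (ClosedNbhd G w)) j → suc b ≤ j) → TripleCoding G N b
      coding zero    _       = trivialCoding
      coding (suc k) minimal = chromaticTriples G N? k λ colourable →
        let c , proper = freshColour G {x = w} colourable in
        ℕ.n≮n _ (minimal (suc k) (c ∘ proj₁ , λ {x} {y} → proper (proj₂ x) (proj₂ y)))
      onto : ∀ {a} → K a → ∃[ i ] e (Fin.punchIn i₀ i) ≡ a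
      onto (x , Nx , refl) with e-onto (inj₂ Nx)
      ... | j , eq = Fin.punchOut i₀≢j , trans (cong e (Fin.punchIn-punchOut i₀≢j)) eq
        where
        i₀≢j : i₀ ≢ j
        i₀≢j refl = independent (trans (sym (proj₂ (e-onto (inj₁ refl)))) eq) Nx

  open CliqueCoding cliqueCoding
  open TripleCoding coding renaming (injective to codes-injective)

  trace? : ∀ D → Decidable (λ i → vertex i ∈ D)
  trace? D i = vertex i ∈? D

  trace : Subset m → Subset size
  trace D = fromPred (trace? D)

  trace-⊆ : ∀ {D D′} → (∀ {a} → a ∈ D → K a) → trace D ≡ trace D′ → D ⊆ D′
  trace-⊆ {D} {D′} inK eq a∈ with vertex-onto (inK a∈)
  ... | i , refl = ∈-fromPred⁻ (trace? D′) (subst (i ∈_) eq (∈-fromPred⁺ (trace? D) a∈))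

  trace-triple : ∀ {D} → (∀ {a} → a ∈ D → K a) → IsTriple D → IsTriple (trace D)
  trace-triple {D} inK (a , b , c , triple a≢b a≢c b≢c a∈ b∈ c∈ onto)
    with vertex-onto (inK a∈) | vertex-onto (inK b∈) | vertex-onto (inK c∈)
  ... | i , refl | j , refl | l , refl = i , j , l ,
    triple (a≢b ∘ cong vertex) (a≢c ∘ cong vertex) (b≢c ∘ cong vertex)
      (∈-fromPred⁺ (trace? D) a∈) (∈-fromPred⁺ (trace? D) b∈) (∈-fromPred⁺ (trace? D) c∈)
      λ t∈ → Sum.map vertex-injective (Sum.map vertex-injective vertex-injective)
        (onto (∈-fromPred⁻ (trace? D) t∈))

  -- In the absence of a neighbour of `y` in the class, `sect a` is the default and the implication
  -- is vacuous. The choice depends on `a` and `y` only, so all edges from `y` into one class are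
  -- compared with the same vertex.
  representative : ∀ a y → ∃[ x ] q x ≡ a × (∀ {x′} → q x′ ≡ a → Adj G x′ y → Adj G x y)
  representative a y with Fin.any? (λ x → (q x Fin.≟ a) ×-dec adj? G x y)
  ... | yes (x , eq , adj) = x , eq , λ _ _ → adj
  ... | no none            = sect a , q-sect a , λ eq adj → contradiction (_ , eq , adj) none

  rep : Fin m → Fin n → Fin n
  rep a y = proj₁ (representative a y)

  q-rep : ∀ a y → q (rep a y) ≡ a
  q-rep a y = proj₁ (proj₂ (representative a y))

  rep-adj : ∀ {x y} → Adj G x y → Adj G (rep (q x) y) y
  rep-adj = proj₂ (proj₂ (representative _ _)) refl

  -- Each constructor stores what is needed to recover its source. `canonical` serves edges at a
  -- representative, including the representatives for `w`, and also edges with both ends outside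
  -- `N`, whose classes are singletons.
  data Code : Item m n → Item n m → Set where
    inClique    : ∀ {D S} → (∀ {a} → a ∈ D → K a) → Codes (trace D) S → Code (cyc D) (cyc S)
    lifted      : ∀ {D S a} → IsInducedCycle H D → a ∈ D → ¬ K a → Covers D S → Code (cyc D) (cyc S)
    throughŵ    : ∀ {D e a b} → K a → K b → Triple D a b ŵ → Ends e a b → Code (cyc D) (edge e)
    nbhdEdge    : ∀ {e S u v} → Ends e u v → N u → N v → Triple S u v w → Code (edge e) (cyc S)
    spareEdge   : ∀ {e S u p} → Ends e u p → N u → ¬ N p → p ≢ w → u ≢ rep (q u) p →
                  w ∈ S → p ∈ S → u ∈ S →
                  (∀ {x} → x ∈ S → x ≡ rep (q u) p ⊎ x ≡ w ⊎ x ≡ u ⊎ x ≡ p) → Code (edge e) (cyc S)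
    canonical   : ∀ {e e′ u y} → Ends e u y → ¬ N y → u ≡ rep (q u) y → Ends e′ (q u) (q y) →
                  Code (edge e) (edge e′)
    spareVertex : ∀ {e u} → Ends e u w → u ≢ rep (q u) w → Code (edge e) (vert u)
    vertexRep   : ∀ {a v} → v ≡ rep a w → Code (vert a) (vert v)

  triple-⊆ : ∀ {D D′ : Subset m} {a b c a′ b′} → Triple D a b c → Triple D′ a′ b′ c →
             (a ≡ a′ × b ≡ b′) ⊎ (a ≡ b′ × b ≡ a′) → D ⊆ D′
  triple-⊆ t t′ eqs x∈ with Triple.onto t x∈ | eqs
  ... | inj₁ refl        | inj₁ (refl , _) = Triple.a∈ t′
  ... | inj₁ refl        | inj₂ (refl , _) = Triple.b∈ t′
  ... | inj₂ (inj₁ refl) | inj₁ (_ , refl) = Triple.b∈ t′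
  ... | inj₂ (inj₁ refl) | inj₂ (_ , refl) = Triple.a∈ t′
  ... | inj₂ (inj₂ refl) | _               = Triple.c∈ t′

  triple-ends : ∀ {S : Subset n} {a b a′ b′ c} → Triple S a b c → Triple S a′ b′ c →
                (a ≡ a′ × b ≡ b′) ⊎ (a ≡ b′ × b ≡ a′)
  triple-ends t t′ with Triple.onto t′ (Triple.a∈ t) | Triple.onto t′ (Triple.b∈ t)
  ... | inj₁ refl        | inj₁ refl        = contradiction refl (Triple.a≢b t)
  ... | inj₁ refl        | inj₂ (inj₁ refl) = inj₁ (refl , refl)
  ... | inj₂ (inj₁ refl) | inj₁ refl        = inj₂ (refl , refl)
  ... | inj₂ (inj₁ refl) | inj₂ (inj₁ refl) = contradiction refl (Triple.a≢b t)
  ... | inj₂ (inj₂ refl) | _                = contradiction refl (Triple.a≢c t)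
  ... | _                | inj₂ (inj₂ refl) = contradiction refl (Triple.b≢c t)

  cycle-not-pair : ∀ {D a b} → IsInducedCycle H D → ¬ (∀ {x} → x ∈ D → x ≡ a ⊎ x ≡ b)
  cycle-not-pair {D} {a} {b} isCyc onto with inducedCycle⇒sequence isCyc
  ... | k , d , cycIn = pigeon (onto (into z<s)) (onto (into (s<s z<s))) (onto (into (s<s (s<s z<s))))
    where
    open CycleIn cycIn using (into; distinct)
    pigeon : d 0 ≡ a ⊎ d 0 ≡ b → d 1 ≡ a ⊎ d 1 ≡ b → d 2 ≡ a ⊎ d 2 ≡ b → ⊥
    pigeon (inj₁ p) (inj₁ q) _        = distinct {0} {1} z<s (s<s z<s) (trans p (sym q))
    pigeon (inj₂ p) (inj₂ q) _        = distinct {0} {1} z<s (s<s z<s) (trans p (sym q))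
    pigeon (inj₁ p) _        (inj₁ r) = distinct {0} {2} z<s (s<s (s<s z<s)) (trans p (sym r))
    pigeon (inj₂ p) _        (inj₂ r) = distinct {0} {2} z<s (s<s (s<s z<s)) (trans p (sym r))
    pigeon _        (inj₁ q) (inj₁ r) = distinct {1} {2} (s<s z<s) (s<s (s<s z<s)) (trans q (sym r))
    pigeon _        (inj₂ q) (inj₂ r) = distinct {1} {2} (s<s z<s) (s<s (s<s z<s)) (trans q (sym r))

  -- This vertex tells a lifted cycle from the cycles inside `N` and from the triangles at `w`.
  code-outside : ∀ {D S a} → a ∈ D → ¬ K a → Covers D S → ∃[ x ] x ∈ S × x ≢ w × ¬ N x
  code-outside a∈ ¬Ka covers with Covers.cover covers a∈
  ... | x , x∈ , x≢w , refl = x , x∈ , x≢w , λ Nx → ¬Ka (x , Nx , refl)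

  codes⊆N : ∀ {T S x} → Codes T S → x ∈ S → N x
  codes⊆N = λ code → proj₂ (valid code)

  triple-N : ∀ {S u v x} → N u → N v → Triple S u v w → x ∈ S → x ≢ w → N x
  triple-N Nu Nv t x∈ x≢w with Triple.onto t x∈
  ... | inj₁ refl        = Nu
  ... | inj₂ (inj₁ refl) = Nv
  ... | inj₂ (inj₂ eq)   = contradiction eq x≢w

  covers-⊆ : ∀ {D D′ S} → Covers D S → Covers D′ S → D ⊆ D′
  covers-⊆ c c′ a∈ with Covers.cover c a∈
  ... | x , x∈ , x≢w , refl = Covers.image c′ x∈ x≢w

  -- Since `u` and its representative share a class, the 4-cycle without `w` has only two images in
  -- `H`, too few for a cycle.
  lifted≢spare : ∀ {D S u p} → IsInducedCycle H D → Covers D S →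
                 (∀ {x} → x ∈ S → x ≡ rep (q u) p ⊎ x ≡ w ⊎ x ≡ u ⊎ x ≡ p) → ⊥
  lifted≢spare {D} {S} {u} {p} isCyc covers onto = cycle-not-pair isCyc pair
    where
    pair : ∀ {a} → a ∈ D → a ≡ q u ⊎ a ≡ q p
    pair a∈ with Covers.cover covers a∈
    ... | x , x∈ , x≢w , refl with onto x∈
    ... | inj₁ refl               = inj₁ (q-rep _ _)
    ... | inj₂ (inj₁ eq)          = contradiction eq x≢w
    ... | inj₂ (inj₂ (inj₁ refl)) = inj₁ refl
    ... | inj₂ (inj₂ (inj₂ refl)) = inj₂ refl

  -- In the 4-cycle `p` is the only vertex outside `N` other than `w`. Once `p` is known, `u` is the
  -- vertex of `N` that is not the representative of its class for `p`.
  spare-same : ∀ {e e′ S u p u′ p′} →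
               Ends e u p → N u → ¬ N p → p ≢ w → p ∈ S → u ∈ S →
               (∀ {x} → x ∈ S → x ≡ rep (q u) p ⊎ x ≡ w ⊎ x ≡ u ⊎ x ≡ p) →
               Ends e′ u′ p′ → N u′ → ¬ N p′ → u ≢ rep (q u) p →
               (∀ {x} → x ∈ S → x ≡ rep (q u′) p′ ⊎ x ≡ w ⊎ x ≡ u′ ⊎ x ≡ p′) → u′ ∈ S →
               u′ ≢ rep (q u′) p′ → e ≡ e′
  spare-same {u = u} {p} {u′} {p′} ends Nu ¬Np p≢w p∈ u∈ onto ends′ Nu′ ¬Np′ u≢ onto′ u′∈ u′≢
    with samePoint (onto′ p∈)
    where
    samePoint : p ≡ rep (q u′) p′ ⊎ p ≡ w ⊎ p ≡ u′ ⊎ p ≡ p′ → p ≡ p′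
    samePoint (inj₁ refl)               = contradiction (N-class Nu′ (sym (q-rep _ _))) ¬Np
    samePoint (inj₂ (inj₁ eq))          = contradiction eq p≢w
    samePoint (inj₂ (inj₂ (inj₁ refl))) = contradiction Nu′ ¬Np
    samePoint (inj₂ (inj₂ (inj₂ eq)))   = eq
  ... | refl with onto u′∈
  ... | inj₁ refl = contradiction (cong (λ a → rep a p) (sym (q-rep (q u) p))) u′≢
  ... | inj₂ (inj₁ refl)        = contradiction Nu′ ¬Nw
  ... | inj₂ (inj₂ (inj₁ refl)) = ends-determine ends ends′
  ... | inj₂ (inj₂ (inj₂ refl)) = contradiction Nu′ ¬Np

  -- The image edge yields `y`, whose class is a singleton, and the class of `u`, in which `u` is
  -- the representative for `y`. If the ends match crosswise, all four vertices lie outside `N` and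
  -- the classes determine them.
  canonical-same : ∀ {e e′ f u y u′ y′} →
                   Ends e u y → ¬ N y → u ≡ rep (q u) y → Ends f (q u) (q y) →
                   Ends e′ u′ y′ → ¬ N y′ → u′ ≡ rep (q u′) y′ → Ends f (q u′) (q y′) → e ≡ e′
  canonical-same ends ¬Ny u≡ f ends′ ¬Ny′ u′≡ f′ with ends-same f f′
  ... | inj₁ (qu , qy) with singleton ¬Ny qy
  ...   | refl with trans u≡ (trans (cong (λ a → rep a _) qu) (sym u′≡))
  ...     | refl = ends-determine ends ends′
  canonical-same ends ¬Ny u≡ f ends′ ¬Ny′ u′≡ f′ | inj₂ (qu , qy)
    with singleton ¬Ny qy | singleton ¬Ny′ (sym qu)
  ... | refl | refl = ends-determine ends (ends-swap ends′)

  canonical≢throughŵ : ∀ {f u y a b} → ¬ N y → Ends f (q u) (q y) → K a → K b → ¬ Ends f a b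
  canonical≢throughŵ ¬Ny f Ka Kb f′ with ends-same f f′
  ... | inj₁ (_ , refl) = ¬Ny (K⇒N Kb)
  ... | inj₂ (_ , refl) = ¬Ny (K⇒N Ka)

  -- Cycles from different constructors are separated by `w`, which `inClique` excludes and the edge
  -- codes contain, and by a vertex outside `N` other than `w`, present for `lifted` and `spareEdge`
  -- only. These last two are separated by the size of their image.
  code-injective : ∀ {x x′ y} → Code x y → Code x′ y → x ≡ x′
  code-injective (inClique inK code) (inClique inK′ code′) = cong cyc
    (⊆-antisym (trace-⊆ inK eq) (trace-⊆ inK′ (sym eq)))
    where eq = codes-injective code code′
  code-injective (inClique _ code) (lifted _ a∈ ¬Ka covers) =
    let _ , x∈ , _ , ¬Nx = code-outside a∈ ¬Ka covers in contradiction (codes⊆N code x∈) ¬Nx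
  code-injective (lifted _ a∈ ¬Ka covers) (inClique _ code) =
    let _ , x∈ , _ , ¬Nx = code-outside a∈ ¬Ka covers in contradiction (codes⊆N code x∈) ¬Nx
  code-injective (inClique _ code) (nbhdEdge _ _ _ t) = contradiction (codes⊆N code (Triple.c∈ t)) ¬Nw
  code-injective (nbhdEdge _ _ _ t) (inClique _ code) = contradiction (codes⊆N code (Triple.c∈ t)) ¬Nw
  code-injective (inClique _ code) (spareEdge _ _ _ _ _ w∈ _ _ _) = contradiction (codes⊆N code w∈) ¬Nw
  code-injective (spareEdge _ _ _ _ _ w∈ _ _ _) (inClique _ code) = contradiction (codes⊆N code w∈) ¬Nw
  code-injective (lifted _ _ _ c) (lifted _ _ _ c′) = cong cyc (⊆-antisym (covers-⊆ c c′) (covers-⊆ c′ c))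
  code-injective (lifted _ a∈ ¬Ka covers) (nbhdEdge _ Nu Nv t) =
    let _ , x∈ , x≢w , ¬Nx = code-outside a∈ ¬Ka covers in contradiction (triple-N Nu Nv t x∈ x≢w) ¬Nx
  code-injective (nbhdEdge _ Nu Nv t) (lifted _ a∈ ¬Ka covers) =
    let _ , x∈ , x≢w , ¬Nx = code-outside a∈ ¬Ka covers in contradiction (triple-N Nu Nv t x∈ x≢w) ¬Nx
  code-injective (lifted isCyc _ _ covers) (spareEdge _ _ _ _ _ _ _ _ onto) =
    ⊥-elim (lifted≢spare isCyc covers onto)
  code-injective (spareEdge _ _ _ _ _ _ _ _ onto) (lifted isCyc _ _ covers) =
    ⊥-elim (lifted≢spare isCyc covers onto)
  code-injective (nbhdEdge ends _ _ t) (nbhdEdge ends′ _ _ t′) = cong edge (case triple-ends t t′ of λ where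
    (inj₁ (refl , refl)) → ends-determine ends ends′
    (inj₂ (refl , refl)) → ends-determine ends (ends-swap ends′))
  code-injective (nbhdEdge _ Nu Nv t) (spareEdge _ _ ¬Np p≢w _ _ p∈ _ _) =
    contradiction (triple-N Nu Nv t p∈ p≢w) ¬Np
  code-injective (spareEdge _ _ ¬Np p≢w _ _ p∈ _ _) (nbhdEdge _ Nu Nv t) =
    contradiction (triple-N Nu Nv t p∈ p≢w) ¬Np
  code-injective (spareEdge ends Nu ¬Np p≢w u≢ _ p∈ u∈ onto)
                 (spareEdge ends′ Nu′ ¬Np′ p′≢w u′≢ _ p′∈ u′∈ onto′) =
    cong edge (spare-same ends Nu ¬Np p≢w p∈ u∈ onto ends′ Nu′ ¬Np′ u≢ onto′ u′∈ u′≢)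
  code-injective (throughŵ _ _ t f) (throughŵ _ _ t′ f′) = cong cyc
    (⊆-antisym (triple-⊆ t t′ (ends-same f f′)) (triple-⊆ t′ t (ends-same f′ f)))
  code-injective (throughŵ Ka Kb _ f) (canonical _ ¬Ny _ f′) = ⊥-elim (canonical≢throughŵ ¬Ny f′ Ka Kb f)
  code-injective (canonical _ ¬Ny _ f′) (throughŵ Ka Kb _ f) = ⊥-elim (canonical≢throughŵ ¬Ny f′ Ka Kb f)
  code-injective (canonical ends ¬Ny u≡ f) (canonical ends′ ¬Ny′ u′≡ f′) =
    cong edge (canonical-same ends ¬Ny u≡ f ends′ ¬Ny′ u′≡ f′)
  code-injective (spareVertex ends _) (spareVertex ends′ _) = cong edge (ends-determine ends ends′)
  -- A vertex of the form `rep a w` lies in the class `a`, so it would be its own representative for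
  -- `w`.
  code-injective (spareVertex _ u≢) (vertexRep {a} refl) =
    contradiction (cong (λ b → rep b w) (sym (q-rep a w))) u≢
  code-injective (vertexRep {a} refl) (spareVertex _ u≢) =
    contradiction (cong (λ b → rep b w) (sym (q-rep a w))) u≢
  code-injective (vertexRep {a} eq) (vertexRep {b} eq′) =
    cong vert (trans (sym (q-rep a w)) (trans (cong q (trans (sym eq) eq′)) (q-rep b w)))

  Coded : Item m n → Set
  Coded x = ∃[ y ] IsItem G H y × Code x y

  cycle-coded : ∀ {D} → IsInducedCycle H D → Coded (cyc D)
  cycle-coded {D} isCyc with ŵ ∈? D
  ... | yes ŵ∈ =
    let _ , _ , Ka , Kb , t = wTriangle isCyc ŵ∈
        e , isEdge , ends = adj⇒edge H (clique Ka Kb (Triple.a≢b t))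
    in edge e , isEdge , throughŵ Ka Kb t ends
  ... | no ŵ∉ with Fin.any? (λ a → (a ∈? D) ×-dec ¬? (K? a))
  ...   | yes (a , a∈ , ¬Ka) =
    let S , isCyc′ , covers = liftCycle ŵ∉ isCyc (a , a∈ , ¬Ka)
    in cyc S , isCyc′ , lifted isCyc a∈ ¬Ka covers
  ...   | no none =
    let inK = λ {a} a∈ → decidable-stable (K? a) λ ¬Ka → none (a , a∈ , ¬Ka)
        S , code = total (trace-triple inK (cliqueTriangle isCyc inK))
    in cyc S , proj₁ (valid code) , inClique inK code

  nbhdEdge-coded : ∀ {e u v} → Ends e u v → Adj G u v → N u → N v → Coded (edge e)
  nbhdEdge-coded {u = u} {v} ends uv Nu Nv =
    let S , isCyc , inS = cycle⇒inducedCycle triangle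
    in cyc S , isCyc , nbhdEdge ends Nu Nv (sequence⇒triple inS)
    where
    triangle : CycleOn G 0 (u ◃ v ◃ λ _ → w)
    triangle = close (extend singletonPath (λ { _ refl → ¬Nw Nv }) (symm G Nv) λ { (s≤s z≤n) _ → refl })
      (λ { {zero} _ refl → irrefl G uv ; {suc _} _ refl → ¬Nw Nu }) uv (symm G Nu)
      λ { {zero} _ _ → inj₁ refl ; {suc zero} _ _ → inj₂ refl ; {suc (suc _)} (s≤s (s≤s ())) _ }

  crossEdge-coded : ∀ {e u p} → Ends e u p → Adj G u p → N u → ¬ N p → p ≢ w → Coded (edge e)
  crossEdge-coded {u = u} {p} ends up Nu ¬Np p≢w with u Fin.≟ rep (q u) p
  ... | yes u≡ = let e′ , isEdge , ends′ = adj⇒edge H (hom up)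
                 in edge e′ , isEdge , canonical ends ¬Np u≡ ends′
  ... | no u≢ =
      let S , isCyc , inS = cycle⇒inducedCycle square
          into = CycleIn.into inS
      in cyc S , isCyc , spareEdge ends Nu ¬Np p≢w u≢ (into {1} (s<s z<s))
           (into {3} (s<s (s<s (s<s z<s)))) (into {2} (s<s (s<s z<s))) (members ∘ CycleIn.onto inS)
    where
    u′ = rep (q u) p
    -- The one-vertex path `p` is closed through `w`; `u` and `u′` are nonadjacent because they
    -- share a class.
    square : CycleOn G 1 (u′ ◃ w ◃ u ◃ λ _ → p)
    square = closeThroughW {0} singletonPath (λ _ → ¬Np) (λ _ → p≢w) Nu (N-class Nu (sym (q-rep _ _)))
      u≢ (independent (q-rep _ _)) up (λ { (s≤s z≤n) _ → refl }) (rep-adj up) λ { (s≤s z≤n) _ → refl }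
    members : ∀ {x} → ∃[ i ] i < 4 × (u′ ◃ w ◃ u ◃ λ _ → p) i ≡ x → x ≡ u′ ⊎ x ≡ w ⊎ x ≡ u ⊎ x ≡ p
    members (0 , _ , eq)                 = inj₁ (sym eq)
    members (1 , _ , eq)                 = inj₂ (inj₁ (sym eq))
    members (2 , _ , eq)                 = inj₂ (inj₂ (inj₁ (sym eq)))
    members (suc (suc (suc _)) , _ , eq) = inj₂ (inj₂ (inj₂ (sym eq)))

  -- The class of `x` is a singleton, so `x` is its own representative and the edge is canonical.
  outerEdge-coded : ∀ {e x y} → Ends e x y → Adj G x y → ¬ N x → ¬ N y → Coded (edge e)
  outerEdge-coded ends xy ¬Nx ¬Ny =
    let e′ , isEdge , ends′ = adj⇒edge H (hom xy)
    in edge e′ , isEdge , canonical ends ¬Ny (singleton ¬Nx (sym (q-rep _ _))) ends′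

  wEdge-coded : ∀ {e u} → Ends e u w → N u → Coded (edge e)
  wEdge-coded {u = u} ends Nu with u Fin.≟ rep (q u) w
  ... | yes u≡ = let e′ , isEdge , ends′ = adj⇒edge H (hom (symm G Nu))
                 in edge e′ , isEdge , canonical ends ¬Nw u≡ ends′
  ... | no u≢ = vert u , tt , spareVertex ends u≢

  edge-coded : ∀ {e} → IsEdge G e → Coded (edge e)
  edge-coded {x , y} (lt , xy) = byCases (N? x) (N? y) (x Fin.≟ w) (y Fin.≟ w)
    where
    ends : Ends (x , y) x y
    ends = lt , inj₁ refl
    byCases : Dec (N x) → Dec (N y) → Dec (x ≡ w) → Dec (y ≡ w) → Coded (edge (x , y))
    byCases (yes Nx) (yes Ny) _          _          = nbhdEdge-coded ends xy Nx Ny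
    byCases (yes Nx) (no ¬Ny) _          (yes refl) = wEdge-coded ends Nx
    byCases (yes Nx) (no ¬Ny) _          (no y≢w)   = crossEdge-coded ends xy Nx ¬Ny y≢w
    byCases (no ¬Nx) (yes Ny) (yes refl) _          = wEdge-coded (ends-swap ends) Ny
    byCases (no ¬Nx) (yes Ny) (no x≢w)   _          =
      crossEdge-coded (ends-swap ends) (symm G xy) Ny ¬Nx x≢w
    byCases (no ¬Nx) (no ¬Ny) _          _          = outerEdge-coded ends xy ¬Nx ¬Ny

  item-coded : ∀ x → IsItem H G x → Coded x
  item-coded (cyc D)  isCyc  = cycle-coded isCyc
  item-coded (edge e) isEdge = edge-coded isEdge
  item-coded (vert a) _      = vert (rep a w) , tt , vertexRep refl

  items-≤ : length (items H G) ≤ length (items G H)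
  items-≤ = length-≤-via Code (items-unique H G)
    (λ {x} x∈ → let y , isItem , code = item-coded x (∈-items⁻ H G x∈) in y , ∈-items⁺ G H isItem , code)
    code-injective

-- From the count of items to the second graph characteristic.

-- Adding `- e - e′` to both sides returns each edge count to the side of its own graph.
characteristic-≤ : ∀ c c′ e e′ v v′ → c′ + (e + v′) ≤ c + (e′ + v) →
  ℤ.+ c′ ℤ.- ℤ.+ e′ ℤ.+ ℤ.+ v′ ℤ.≤ ℤ.+ c ℤ.- ℤ.+ e ℤ.+ ℤ.+ v
characteristic-≤ c c′ e e′ v v′ le = subst₂ ℤ._≤_
  (shift (ℤ.+ c′) (ℤ.+ e) (ℤ.+ v′) (ℤ.+ e′))
  (shift′ (ℤ.+ c) (ℤ.+ e) (ℤ.+ v) (ℤ.+ e′))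
  (ℤ.+-monoˡ-≤ (ℤ.- ℤ.+ e ℤ.- ℤ.+ e′) (ℤ.+≤+ le))
  where
  open ℤ.+-*-Solver
  shift : ∀ c e v f → (c ℤ.+ (e ℤ.+ v)) ℤ.+ (ℤ.- e ℤ.- f) ≡ c ℤ.- f ℤ.+ v
  shift = solve 4 (λ c e v f → (c :+ (e :+ v)) :+ (:- e :- f) := c :- f :+ v) refl
  shift′ : ∀ c e v f → (c ℤ.+ (f ℤ.+ v)) ℤ.+ (ℤ.- e ℤ.- f) ≡ c ℤ.- e ℤ.+ v
  shift′ = solve 4 (λ c e v f → (c :+ (f :+ v)) :+ (:- e :- f) := c :- e :+ v) refl

theorem3p2p1 : ∀ {n m : ℕ} (G : Graph (Fin n)) (w : Fin n) (H : Graph (Fin m)) →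
    Connected G → IsVertexCompression G w H → ℶ² H ℤ.≤ ℶ² G
theorem3p2p1 {n} {m} G w H _ compression = characteristic-≤
  (length (inducedCycles G)) (length (inducedCycles H)) (length (edges G)) (length (edges H)) n m
  (subst₂ _≤_ (length-items H G) (length-items G H) (Counting.items-≤ G w H compression))
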